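{- Let $q>4$ be a prime power. Then there exists $b\in\mathbb{F}_{q^2}^*$ such that $$U_{b,1}=\{(x,bx^q+x^{q^4})\colon x\in\mathbb{F}_{q^6}\}$$ is a maximum scattered $\mathbb{F}_q$-subspace of $\mathbb{F}_{q^6}\times\mathbb{F}_{q^6}$.
   Context: An $\mathbb{F}_q$-subspace $U$ of $\mathbb{F}_{q^m}\times\mathbb{F}_{q^m}$ is scattered if $\dim_{\mathbb{F}_q}(\langle \mathbf{v}\rangle_{\mathbb{F}_{q^m}}\cap U)\leq 1$ for every nonzero $\mathbf{v}\in\mathbb{F}_{q^m}\times\mathbb{F}_{q^m}$. It is maximum scattered if it is scattered and has the largest possible $\mathbb{F}_q$-dimension among scattered $\mathbb{F}_q$-subspaces of $\mathbb{F}_{q^m}\times\mathbb{F}_{q^m}$; this largest dimension is $m$. -}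

module Defs where

open import Algebra.Bundles using (Ring; CommutativeRing)
open import Algebra.Module.Bundles using (LeftModule)
import Algebra.Module.Construct.DirectProduct as DirectProduct
import Algebra.Module.Construct.TensorUnit as TensorUnit
open import Algebra.Morphism.Bundles using (RingHomomorphism)
import Algebra.Properties.CommutativeMonoid.Sum as Sum
import Algebra.Properties.Semiring.Exp as Exp
open import Data.Fin using (Fin)
open import Data.Nat as ℕ using (ℕ)
open import Data.Nat.Primality using (Prime)
open import Data.Product using (∃; ∃₂; _×_; _,_)
open import Data.Vec.Functional using (Vector)
open import Function.Bundles using (Inverse)
open import Level using (Level; _⊔_; suc)
open import Relation.Binary.PropositionalEquality as ≡ using (_≡_)
open import Relation.Nullary using (¬_)
open import Relation.Unary using (Pred; _∩_)

IsPrimePower : ℕ → Set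
IsPrimePower q = ∃₂ λ p k → Prime p × 1 ℕ.≤ k × q ≡ p ℕ.^ k

-- The classical notion of field, with no separate apartness relation; on the
-- finite fields considered here equality is decidable, so nothing is lost
-- against a Heyting field.
record Field (c ℓ : Level) : Set (suc (c ⊔ ℓ)) where
  field
    commutativeRing : CommutativeRing c ℓ

  open CommutativeRing commutativeRing public

  field
    1≉0      : ¬ (1# ≈ 0#)
    inverses : ∀ x → ¬ (x ≈ 0#) → ∃ λ y → x * y ≈ 1#

HasOrder : ∀ {c ℓ} → Field c ℓ → ℕ → Set (c ⊔ ℓ)
HasOrder K n = Inverse (≡.setoid (Fin n)) (Field.setoid K)

-- Homomorphisms of fields are automatically injective, so these are exactly
-- the field extensions K / F.
Embedding : ∀ {c ℓ} → Field c ℓ → Field c ℓ → Set (c ⊔ ℓ)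
Embedding F K = RingHomomorphism (Field.rawRing F) (Field.rawRing K)

module LinearAlgebra {r ℓr m ℓm} {R : Ring r ℓr} (M : LeftModule R m ℓm) where
  open Ring R using (Carrier; _≈_; 0#)
  open LeftModule M
  open Sum +ᴹ-commutativeMonoid using (sum)

  record IsSubspace {p} (U : Pred Carrierᴹ p) : Set (r ⊔ m ⊔ ℓm ⊔ p) where
    field
      respects  : ∀ {u v} → u ≈ᴹ v → U u → U v
      0-closed  : U 0ᴹ
      +-closed  : ∀ {u v} → U u → U v → U (u +ᴹ v)
      *ₗ-closed : ∀ a {u} → U u → U (a *ₗ u)

  linearCombination : ∀ {n} → Vector Carrier n → Vector Carrierᴹ n → Carrierᴹ
  linearCombination a v = sum λ i → a i *ₗ v i

  LinearlyIndependent : ∀ {n} → Vector Carrierᴹ n → Set (r ⊔ ℓr ⊔ ℓm)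
  LinearlyIndependent v =
    ∀ a → linearCombination a v ≈ᴹ 0ᴹ → ∀ i → a i ≈ 0#

  record IsBasis {p n} (U : Pred Carrierᴹ p) (v : Vector Carrierᴹ n)
                 : Set (r ⊔ ℓr ⊔ m ⊔ ℓm ⊔ p) where
    field
      contained   : ∀ i → U (v i)
      independent : LinearlyIndependent v
      spanning    : ∀ {u} → U u → ∃ λ a → u ≈ᴹ linearCombination a v

  HasDimension : ∀ {p} → Pred Carrierᴹ p → ℕ → Set (r ⊔ ℓr ⊔ m ⊔ ℓm ⊔ p)
  HasDimension U n = ∃ λ (v : Vector Carrierᴹ n) → IsBasis U v

  ⟨_⟩ : Carrierᴹ → Pred Carrierᴹ (r ⊔ ℓm)
  ⟨ v ⟩ u = ∃ λ a → u ≈ᴹ a *ₗ v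

restrictScalars : ∀ {r ℓr s ℓs m ℓm} {R : Ring r ℓr} {S : Ring s ℓs} →
                  RingHomomorphism (Ring.rawRing R) (Ring.rawRing S) →
                  LeftModule S m ℓm → LeftModule R m ℓm
restrictScalars f M = record
  { Carrierᴹ = Carrierᴹ
  ; _≈ᴹ_ = _≈ᴹ_
  ; _+ᴹ_ = _+ᴹ_
  ; _*ₗ_ = λ a v → ⟦ a ⟧ *ₗ v
  ; 0ᴹ   = 0ᴹ
  ; -ᴹ_  = -ᴹ_
  ; isLeftModule = record
    { isLeftSemimodule = record
      { +ᴹ-isCommutativeMonoid = +ᴹ-isCommutativeMonoid
      ; isPreleftSemimodule = record
        { *ₗ-cong      = λ a≈b → *ₗ-cong (⟦⟧-cong a≈b)
        ; *ₗ-zeroˡ     = λ v → ≈ᴹ-trans (*ₗ-cong 0#-homo ≈ᴹ-refl) (*ₗ-zeroˡ v)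
        ; *ₗ-distribʳ  = λ v a b →
            ≈ᴹ-trans (*ₗ-cong (+-homo a b) ≈ᴹ-refl) (*ₗ-distribʳ v ⟦ a ⟧ ⟦ b ⟧)
        ; *ₗ-identityˡ = λ v →
            ≈ᴹ-trans (*ₗ-cong 1#-homo ≈ᴹ-refl) (*ₗ-identityˡ v)
        ; *ₗ-assoc     = λ a b v →
            ≈ᴹ-trans (*ₗ-cong (*-homo a b) ≈ᴹ-refl) (*ₗ-assoc ⟦ a ⟧ ⟦ b ⟧ v)
        ; *ₗ-zeroʳ     = λ a → *ₗ-zeroʳ ⟦ a ⟧
        ; *ₗ-distribˡ  = λ a → *ₗ-distribˡ ⟦ a ⟧
        }
      }
    ; -ᴹ‿cong    = -ᴹ‿cong
    ; -ᴹ‿inverse = -ᴹ‿inverse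
    }
  }
  where
  open LeftModule M
  open RingHomomorphism f

module Scattered {c ℓ} (F K : Field c ℓ) (ι : Embedding F K) where

  plane : LeftModule (Field.ring K) c ℓ
  plane = DirectProduct.leftModule TensorUnit.leftModule TensorUnit.leftModule

  planeOverF : LeftModule (Field.ring F) c ℓ
  planeOverF = restrictScalars {R = Field.ring F} {S = Field.ring K} ι plane

  open LeftModule plane using (Carrierᴹ; _≈ᴹ_; 0ᴹ)
  open LinearAlgebra plane using (⟨_⟩)
  open LinearAlgebra planeOverF using (IsSubspace; HasDimension)

  IsScattered : ∀ {p} → Pred Carrierᴹ p → Set (c ⊔ ℓ ⊔ p)
  IsScattered U = ∀ v → ¬ (v ≈ᴹ 0ᴹ) →
    ∃ λ d → d ℕ.≤ 1 × HasDimension (⟨ v ⟩ ∩ U) d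

  -- The competitors W range over predicates of level c ⊔ ℓ. This loses no
  -- generality: a subspace with a basis is equivalent to its span, which
  -- lives at that level.
  record IsMaximumScattered {p} (U : Pred Carrierᴹ p)
                            : Set (suc (c ⊔ ℓ) ⊔ p) where
    field
      isSubspace   : IsSubspace U
      isScattered  : IsScattered U
      dimension    : ℕ
      hasDimension : HasDimension U dimension
      maximum      : ∀ (W : Pred Carrierᴹ (c ⊔ ℓ)) → IsSubspace W →
                    IsScattered W → ∀ e → HasDimension W e →
                    e ℕ.≤ dimension

module _ {c ℓ} (K : Field c ℓ) where
  open Field K
  open Exp semiring using (_^_)

  U⟨_,1⟩ : Carrier → ℕ → Pred (Carrier × Carrier) (c ⊔ ℓ)
  U⟨_,1⟩ b q (y , z) =
    ∃ λ x → y ≈ x × z ≈ b * x ^ q + x ^ (q ℕ.^ 4)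

{-# OPTIONS --safe #-}
module Submission where

open import Algebra.Bundles using (CommutativeMonoid; CommutativeRing)
open import Algebra.Module.Bundles using (LeftModule)
open import Algebra.Morphism.Bundles using (RingHomomorphism)
import Algebra.Properties.AbelianGroup as AbelianGroupProperties
import Algebra.Properties.CommutativeMonoid.Sum as MonoidSum
import Algebra.Properties.CommutativeSemiring.Binomial as Binomial
import Algebra.Properties.CommutativeSemiring.Exp as Exp
import Algebra.Properties.Group as GroupProperties
import Algebra.Properties.Ring as RingProperties
import Algebra.Properties.Semiring.Mult as SemiringMult
import Algebra.Properties.Semiring.Mult.TCOptimised as SemiringMult′
import Algebra.Solver.Ring as RingSolver
open import Algebra.Solver.Ring.AlmostCommutativeRing
  using (fromCommutativeRing; _-Raw-AlmostCommutative⟶_)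
open import Data.Empty using (⊥)
open import Data.Fin as Fin using (Fin; zero; suc; punchIn; toℕ; finToFun; funToFin)
open import Data.Fin.Permutation using (Permutation; permutation)
import Data.Fin.Properties as Fin
open import Data.Integer as ℤ using (ℤ; +_; -[1+_])
import Data.Integer.Properties as ℤ
open import Data.Maybe using (Maybe; just; nothing)
open import Data.Nat as ℕ using (ℕ; zero; suc)
open import Data.Nat.Combinatorics using (_C_; nCn≡1; nCk≡n!/k![n-k]!; k![n∸k]!∣n!)
open import Data.Nat.Divisibility using (_∣_; divides; ∣⇒≤; m∣m*n)
open import Data.Nat.DivMod using (m/n*n≡m)
open import Data.Nat.Primality using (Prime; euclidsLemma; ¬prime[0]; ¬prime[1])
import Data.Nat.Properties as ℕ
open import Data.Nat.Properties using (_!*_!≢0)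
import Data.Nat.Tactic.RingSolver as ℕSolver
open import Data.Product using (∃; ∃₂; _×_; _,_; proj₁; proj₂)
open import Data.Sum using (_⊎_; inj₁; inj₂)
open import Data.Vec.Functional using (Vector; []; _∷_; head; tail)
open import Function.Base using (_∘_)
open import Function.Bundles using (Inverse)
open import Level using (_⊔_)
open import Relation.Binary.Definitions using (Decidable)
open import Relation.Binary.PropositionalEquality as ≡ using (_≡_)
import Relation.Binary.Reasoning.Setoid as SetoidReasoning
open import Relation.Nullary using (¬_; Dec; yes; no; contradiction)
open import Relation.Nullary.Decidable using (map′; decidable-stable; ¬?; _×-dec_)
open import Relation.Unary using (Pred)
open import Defs

-- Write f(x) = b x^q + x^(q⁴). If y = t x and x f(y) = y f(x), then
-- b x^q (t^q − t) = x^(q⁴) (t − t^(q⁴)); multiplying this by its image under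
-- x ↦ x^(q³) eliminates x. With Pᵢ = t^(qⁱ) and B = b^(q+1) ∈ 𝔽_q it leaves
--   (P₀ − P₄)(P₃ − P₁) = B (P₁ − P₀)(P₄ − P₃),
-- a cross-ratio condition invariant under Frobenius. Moving P₃ to 0 and P₀ to ∞
-- turns it and its first two Frobenius images into z² − (B + 1) z + 1 = 0, where
-- z is a cross-ratio of P₀, P₂, P₃, P₄ whose Frobenius image is 1/z. So if
-- B + 1 = u + 1/u with u ∈ 𝔽_q, then z is u or 1/u, whence u² = 1 unless
-- t ∈ 𝔽_q. It remains to find u ∈ 𝔽_q with u ≠ 0, u² ≠ 1 and
-- u² − u + 1 ≠ 0 (that is, B ≠ 0), which is possible exactly when q > 4, and to
-- take b with norm B. Scattered subspaces of dimension at least 7 are excluded by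
-- counting the q⁶ + 1 points of the projective line.

-- That u lies in 𝔽_q is the source of the contradiction. The two roots of the quadratic have
-- product 1, so if it were irreducible over 𝔽_q, Frobenius would exchange them and sending z to 1/z
-- would be consistent; a root in 𝔽_q is fixed by Frobenius instead. In the actual computation the
-- quadratic appears multiplied by 1 - B; the case B = 1 means u + 1/u = 2, that is u = 1, and is
-- covered by u² ≠ 1. The three fields are known only through their orders. Translations and
-- scalings permute the elements of a finite field, which gives the characteristic and x^N = x for
-- the order N; fixed fields are then identified by counting roots. The embeddings of 𝔽_q and 𝔽_{q²}
-- are not assumed compatible, so their images are compared as fixed points of powers of Frobenius.

-- Polynomial identities with integer coefficients

module IntegerSolver {c ℓ} (R : CommutativeRing c ℓ) where
  open CommutativeRing R
  open AbelianGroupProperties +-abelianGroup using (⁻¹-∙-comm)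
  open GroupProperties +-group using (ε⁻¹≈ε; ⁻¹-involutive)
  open RingProperties ring using (-‿distribˡ-*; -‿distribʳ-*)
  open SemiringMult′ semiring using (×-homo-+; ×1-homo-*) renaming (_×_ to _×ₙ_)
  open SetoidReasoning setoid

  private
    -- The optimised multiples make `⟦ + 0 ⟧` and `⟦ + 1 ⟧` reduce to `0#` and `1#`, so `con (+ 1)`
    -- matches a literal `1#` in the goals. Integer coefficients have decidable equality in every
    -- ring, which lets the solver cancel terms.
    ⟦_⟧ : ℤ → Carrier
    ⟦ + n ⟧      = n ×ₙ 1#
    ⟦ -[1+ n ] ⟧ = - (suc n ×ₙ 1#)

    1+ : ∀ n → suc n ×ₙ 1# ≈ 1# + n ×ₙ 1#
    1+ n = ×-homo-+ 1# 1 n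

    cancel : ∀ x y z → (x + y) - (x + z) ≈ y - z
    cancel x y z = begin
      (x + y) - (x + z)     ≈⟨ +-congˡ (⁻¹-∙-comm x z) ⟨
      (x + y) + (- x - z)   ≈⟨ +-congʳ (+-comm x y) ⟩
      (y + x) + (- x - z)   ≈⟨ +-assoc y x _ ⟩
      y + (x + (- x - z))   ≈⟨ +-congˡ (+-assoc x (- x) (- z)) ⟨
      y + ((x - x) - z)     ≈⟨ +-congˡ (+-congʳ (-‿inverseʳ x)) ⟩
      y + (0# - z)          ≈⟨ +-congˡ (+-identityˡ _) ⟩
      y - z                 ∎

    ⊖-homo : ∀ m n → ⟦ m ℤ.⊖ n ⟧ ≈ m ×ₙ 1# - n ×ₙ 1#
    ⊖-homo m zero = begin
      m ×ₙ 1#        ≈⟨ +-identityʳ _ ⟨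
      m ×ₙ 1# + 0#   ≈⟨ +-congˡ ε⁻¹≈ε ⟨
      m ×ₙ 1# - 0#   ∎
    ⊖-homo zero (suc n) = sym (+-identityˡ _)
    ⊖-homo (suc m) (suc n) = begin
      ⟦ suc m ℤ.⊖ suc n ⟧                  ≡⟨ ≡.cong ⟦_⟧ (ℤ.[1+m]⊖[1+n]≡m⊖n m n) ⟩
      ⟦ m ℤ.⊖ n ⟧                          ≈⟨ ⊖-homo m n ⟩
      m ×ₙ 1# - n ×ₙ 1#                    ≈⟨ cancel 1# _ _ ⟨
      (1# + m ×ₙ 1#) - (1# + n ×ₙ 1#)      ≈⟨ +-cong (1+ m) (-‿cong (1+ n)) ⟨
      suc m ×ₙ 1# - suc n ×ₙ 1#            ∎

    -‿homo : ∀ i → ⟦ ℤ.- i ⟧ ≈ - ⟦ i ⟧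
    -‿homo (+ zero)   = sym ε⁻¹≈ε
    -‿homo (+ suc n)  = refl
    -‿homo -[1+ n ]   = sym (⁻¹-involutive _)

    +-homo : ∀ i j → ⟦ i ℤ.+ j ⟧ ≈ ⟦ i ⟧ + ⟦ j ⟧
    +-homo (+ m)     (+ n)     = ×-homo-+ 1# m n
    +-homo (+ m)     -[1+ n ]  = ⊖-homo m (suc n)
    +-homo -[1+ m ]  (+ n)     = trans (⊖-homo n (suc m)) (+-comm _ _)
    +-homo -[1+ m ]  -[1+ n ]  = begin
      - (suc (suc (m ℕ.+ n)) ×ₙ 1#)       ≡⟨ ≡.cong (λ k → - (k ×ₙ 1#)) (ℕ.+-suc (suc m) n) ⟨
      - ((suc m ℕ.+ suc n) ×ₙ 1#)         ≈⟨ -‿cong (×-homo-+ 1# (suc m) (suc n)) ⟩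
      - (suc m ×ₙ 1# + suc n ×ₙ 1#)       ≈⟨ ⁻¹-∙-comm _ _ ⟨
      - (suc m ×ₙ 1#) - (suc n ×ₙ 1#)     ∎

    pos-*-homo : ∀ m j → ⟦ + m ℤ.* j ⟧ ≈ m ×ₙ 1# * ⟦ j ⟧
    pos-*-homo m (+ n) = begin
      ⟦ + m ℤ.* + n ⟧      ≡⟨ ≡.cong ⟦_⟧ (ℤ.pos-* m n) ⟨
      (m ℕ.* n) ×ₙ 1#      ≈⟨ ×1-homo-* m n ⟩
      m ×ₙ 1# * n ×ₙ 1#    ∎
    pos-*-homo m -[1+ n ] = begin
      ⟦ + m ℤ.* -[1+ n ] ⟧           ≡⟨ ≡.cong ⟦_⟧ (ℤ.neg-distribʳ-* (+ m) (+ suc n)) ⟨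
      ⟦ ℤ.- (+ m ℤ.* + suc n) ⟧      ≈⟨ -‿homo (+ m ℤ.* + suc n) ⟩
      - ⟦ + m ℤ.* + suc n ⟧          ≈⟨ -‿cong (pos-*-homo m (+ suc n)) ⟩
      - (m ×ₙ 1# * suc n ×ₙ 1#)      ≈⟨ -‿distribʳ-* _ _ ⟩
      m ×ₙ 1# * - (suc n ×ₙ 1#)      ∎

    *-homo : ∀ i j → ⟦ i ℤ.* j ⟧ ≈ ⟦ i ⟧ * ⟦ j ⟧
    *-homo (+ m)    j = pos-*-homo m j
    *-homo -[1+ m ] j = begin
      ⟦ -[1+ m ] ℤ.* j ⟧           ≡⟨ ≡.cong ⟦_⟧ (ℤ.neg-distribˡ-* (+ suc m) j) ⟨
      ⟦ ℤ.- (+ suc m ℤ.* j) ⟧      ≈⟨ -‿homo (+ suc m ℤ.* j) ⟩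
      - ⟦ + suc m ℤ.* j ⟧          ≈⟨ -‿cong (pos-*-homo (suc m) j) ⟩
      - (suc m ×ₙ 1# * ⟦ j ⟧)      ≈⟨ -‿distribˡ-* _ _ ⟩
      - (suc m ×ₙ 1#) * ⟦ j ⟧      ∎

    morphism : ℤ.+-*-rawRing -Raw-AlmostCommutative⟶ fromCommutativeRing R
    morphism = record
      { ⟦_⟧    = ⟦_⟧
      ; +-homo = +-homo
      ; *-homo = *-homo
      ; -‿homo = -‿homo
      ; 0-homo = refl
      ; 1-homo = refl
      }

    _coeff≟_ : ∀ i j → Maybe (⟦ i ⟧ ≈ ⟦ j ⟧)
    i coeff≟ j with i ℤ.≟ j
    ... | yes i≡j = just (reflexive (≡.cong ⟦_⟧ i≡j))
    ... | no  _   = nothing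

  open RingSolver ℤ.+-*-rawRing (fromCommutativeRing R) morphism _coeff≟_ public
    using (solve; _:=_; _:+_; _:*_; _:-_; :-_; con)

-- Cancellation and division in a field

module FieldProperties {c ℓ} (K : Field c ℓ) where
  open Field K hiding (zero)
  open Exp commutativeSemiring using (_^_)
  open GroupProperties +-group public
    using () renaming (x∙y⁻¹≈ε⇒x≈y to x-y≈0⇒x≈y; x≈y⇒x∙y⁻¹≈ε to x≈y⇒x-y≈0)
  open SetoidReasoning setoid

  *-cancelˡ : ∀ {x y z} → ¬ (x ≈ 0#) → x * y ≈ x * z → y ≈ z
  *-cancelˡ {x} {y} {z} x≉0 xy≈xz with x⁻¹ , xx⁻¹≈1 ← inverses x x≉0 = begin
    y                ≈⟨ expand y ⟩
    x⁻¹ * (x * y)    ≈⟨ *-congˡ xy≈xz ⟩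
    x⁻¹ * (x * z)    ≈⟨ expand z ⟨
    z                ∎
    where
    expand : ∀ w → w ≈ x⁻¹ * (x * w)
    expand w = begin
      w                ≈⟨ *-identityˡ w ⟨
      1# * w           ≈⟨ *-congʳ xx⁻¹≈1 ⟨
      (x * x⁻¹) * w    ≈⟨ *-congʳ (*-comm x x⁻¹) ⟩
      (x⁻¹ * x) * w    ≈⟨ *-assoc x⁻¹ x w ⟩
      x⁻¹ * (x * w)    ∎

  xy≈0⇒y≈0 : ∀ {x y} → ¬ (x ≈ 0#) → x * y ≈ 0# → y ≈ 0#
  xy≈0⇒y≈0 x≉0 xy≈0 = *-cancelˡ x≉0 (trans xy≈0 (sym (zeroʳ _)))

  *-≉0 : ∀ {x y} → ¬ (x ≈ 0#) → ¬ (y ≈ 0#) → ¬ (x * y ≈ 0#)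
  *-≉0 x≉0 y≉0 xy≈0 = y≉0 (xy≈0⇒y≈0 x≉0 xy≈0)

  x-y≉0 : ∀ {x y} → ¬ (x ≈ y) → ¬ (x - y ≈ 0#)
  x-y≉0 x≉y x-y≈0 = x≉y (x-y≈0⇒x≈y _ _ x-y≈0)

  divide : ∀ x {y} → ¬ (y ≈ 0#) → ∃ λ z → z * y ≈ x
  divide x {y} y≉0 with y⁻¹ , yy⁻¹≈1 ← inverses y y≉0 = x * y⁻¹ , (begin
    x * y⁻¹ * y    ≈⟨ *-assoc x y⁻¹ y ⟩
    x * (y⁻¹ * y)  ≈⟨ *-congˡ (*-comm y⁻¹ y) ⟩
    x * (y * y⁻¹)  ≈⟨ *-congˡ yy⁻¹≈1 ⟩
    x * 1#         ≈⟨ *-identityʳ x ⟩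
    x              ∎)

  0^ : ∀ n .{{_ : ℕ.NonZero n}} → 0# ^ n ≈ 0#
  0^ (suc n) = zeroˡ _

-- The cross-ratio argument

module CrossRatio {c ℓ} (K : Field c ℓ) where
  open Field K hiding (zero)
  open FieldProperties K
  open IntegerSolver commutativeRing
  open SetoidReasoning setoid

  -- Here x and y are the images of p and q under w ↦ (w - b)/(w - a), a Möbius map of determinant b
  -- - a. The formula trades differences of images for differences of points with denominators
  -- cleared.
  difference-of-quotients : ∀ a b {x y p q} → x * (p - a) ≈ p - b → y * (q - a) ≈ q - b →
    (x - y) * ((p - a) * (q - a)) ≈ (b - a) * (p - q)
  difference-of-quotients a b {x} {y} {p} {q} xp yq = begin
    (x - y) * ((p - a) * (q - a))
      ≈⟨ solve 5 (λ x y p q a → (x :- y) :* ((p :- a) :* (q :- a)) :=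
           (x :* (p :- a)) :* (q :- a) :- (y :* (q :- a)) :* (p :- a)) refl x y p q a ⟩
    (x * (p - a)) * (q - a) - (y * (q - a)) * (p - a)
      ≈⟨ +-cong (*-congʳ xp) (-‿cong (*-congʳ yq)) ⟩
    (p - b) * (q - a) - (q - b) * (p - a)
      ≈⟨ solve 4 (λ a b p q → (p :- b) :* (q :- a) :- (q :- b) :* (p :- a) :=
           (b :- a) :* (p :- q)) refl a b p q ⟩
    (b - a) * (p - q) ∎

  module _ (φ : RingHomomorphism rawRing rawRing) where
    open RingHomomorphism φ renaming (⟦_⟧ to σ)

    σ-‿- : ∀ x y → σ (x - y) ≈ σ x - σ y
    σ-‿- x y = trans (+-homo x (- y)) (+-congˡ (-‿homo y))

    -- The hypothesis on `B * u` is B + 1 = u + 1/u multiplied by u.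
    no-cross-ratio : ∀ {u B t} → σ u ≈ u → σ B ≈ B →
      ¬ (u * u ≈ 1#) → ¬ (B ≈ 0#) → B * u ≈ u * u + 1# - u →
      σ (σ (σ (σ (σ (σ t))))) ≈ t → ¬ (σ t ≈ t) →
      ¬ ((t - σ (σ (σ (σ t)))) * (σ (σ (σ t)) - σ t) ≈ B * ((σ t - t) * (σ (σ (σ (σ t))) - σ (σ (σ t)))))
    no-cross-ratio {u} {B} {t} σu σB u²≉1 B≉0 Bu σ⁶t σt≉t e₀ = conclusion
      where
      P₀ P₁ P₂ P₃ P₄ P₅ : Carrier
      P₀ = t
      P₁ = σ P₀
      P₂ = σ P₁
      P₃ = σ P₂
      P₄ = σ P₃
      P₅ = σ P₄

      σ-*[x-y][z-w] : ∀ m x y z w → σ m ≈ m →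
        σ (m * ((x - y) * (z - w))) ≈ m * ((σ x - σ y) * (σ z - σ w))
      σ-*[x-y][z-w] m x y z w σm = trans (*-homo _ _) (*-cong σm
        (trans (*-homo _ _) (*-cong (σ-‿- x y) (σ-‿- z w))))

      σ-step : ∀ {m n a b c d e f g h} → σ m ≈ m → σ n ≈ n →
        m * ((a - b) * (c - d)) ≈ n * ((e - f) * (g - h)) →
        m * ((σ a - σ b) * (σ c - σ d)) ≈ n * ((σ e - σ f) * (σ g - σ h))
      σ-step σm σn eq = trans (sym (σ-*[x-y][z-w] _ _ _ _ _ σm))
        (trans (⟦⟧-cong eq) (σ-*[x-y][z-w] _ _ _ _ _ σn))

      e₁ : (P₁ - P₅) * (P₄ - P₂) ≈ B * ((P₂ - P₁) * (P₅ - P₄))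
      e₁ = trans (sym (*-identityˡ _)) (σ-step 1#-homo σB (trans (*-identityˡ _) e₀))

      -- The sixth point wraps around to `P₀`, so the three relations involve only six points.
      e₂ : (P₂ - P₀) * (P₅ - P₃) ≈ B * ((P₃ - P₂) * (P₀ - P₅))
      e₂ = trans (*-congʳ (+-congˡ (-‿cong (sym σ⁶t)))) (trans (trans (sym (*-identityˡ _)) (σ-step 1#-homo σB (trans (*-identityˡ _) e₁)))
             (*-congˡ (*-congˡ (+-congʳ σ⁶t))))

      -- On elements fixed by σ⁶, the map σ⁵ undoes σ.
      σ-≉ : ∀ {x y} → ¬ (x ≈ y) → σ (σ (σ (σ (σ (σ x))))) ≈ x → σ (σ (σ (σ (σ (σ y))))) ≈ y → ¬ (σ x ≈ σ y)
      σ-≉ x≉y x₆ y₆ eq = x≉y (trans (sym x₆) (trans (σ⁵-cong eq) y₆))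
        where
        σ⁵-cong : ∀ {v w} → σ v ≈ σ w → σ (σ (σ (σ (σ (σ v))))) ≈ σ (σ (σ (σ (σ (σ w)))))
        σ⁵-cong e = ⟦⟧-cong (⟦⟧-cong (⟦⟧-cong (⟦⟧-cong (⟦⟧-cong e))))

      s₁ = ⟦⟧-cong σ⁶t
      s₂ = ⟦⟧-cong s₁
      s₃ = ⟦⟧-cong s₂

      P₅≉P₀ : ¬ (P₅ ≈ P₀)
      P₅≉P₀ eq = σt≉t (trans (sym (⟦⟧-cong eq)) σ⁶t)

      P₄≉P₃ : ¬ (P₄ ≈ P₃)
      P₄≉P₃ = σ-≉ (σ-≉ (σ-≉ σt≉t s₁ σ⁶t) s₂ s₁) s₃ s₂

      -- Otherwise the left side of `e₀` vanishes, while the right side is a product of nonzero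
      -- factors because B ≠ 0. The next inequality reduces to this one, since σ² t = t would give
      -- σ⁴ t = t.
      P₄≉P₀ : ¬ (P₄ ≈ P₀)
      P₄≉P₀ eq = *-≉0 B≉0 (*-≉0 (x-y≉0 σt≉t) (x-y≉0 P₄≉P₃))
        (trans (sym e₀) (trans (*-congʳ (x≈y⇒x-y≈0 (sym eq))) (zeroˡ _)))

      P₂≉P₀ : ¬ (P₂ ≈ P₀)
      P₂≉P₀ eq = P₄≉P₀ (trans (⟦⟧-cong (⟦⟧-cong eq)) eq)

      A₁ = P₁ - P₀
      A₂ = P₂ - P₀
      A₄ = P₄ - P₀
      A₅ = P₅ - P₀
      A₁≉0 = x-y≉0 σt≉t
      A₂≉0 = x-y≉0 P₂≉P₀
      A₄≉0 = x-y≉0 P₄≉P₀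
      A₅≉0 = x-y≉0 P₅≉P₀

      -- The images of P₁, P₂, P₄, P₅ under the Möbius map x ↦ (x − P₃)/(x − P₀).
      d₁ = divide (P₁ - P₃) A₁≉0
      d₂ = divide (P₂ - P₃) A₂≉0
      d₄ = divide (P₄ - P₃) A₄≉0
      d₅ = divide (P₅ - P₃) A₅≉0
      y₁ = proj₁ d₁
      s  = proj₁ d₂
      r  = proj₁ d₄
      y₅ = proj₁ d₅
      h₁ = proj₂ d₁
      h₂ = proj₂ d₂
      h₄ = proj₂ d₄
      h₅ = proj₂ d₅

      r≉0 : ¬ (r ≈ 0#)
      r≉0 r≈0 = x-y≉0 P₄≉P₃ (trans (sym h₄) (trans (*-congʳ r≈0) (zeroˡ _)))

      -- Each side of `e₀` has one difference with `P₀` and one with `P₃`; once these two points are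
      -- at ∞ and 0 the relation becomes linear. The same happens to `e₂` below, so only `e₁`
      -- remains as a condition on r and s.
      y₁≈Br : y₁ ≈ B * r
      y₁≈Br = *-cancelˡ (*-≉0 A₁≉0 A₄≉0) (begin
        A₁ * A₄ * y₁
          ≈⟨ solve 3 (λ a b y → a :* b :* y := b :* (y :* a)) refl A₁ A₄ y₁ ⟩
        A₄ * (y₁ * A₁)
          ≈⟨ *-congˡ h₁ ⟩
        (P₄ - P₀) * (P₁ - P₃)
          ≈⟨ solve 4 (λ a b c d → (a :- b) :* (c :- d) := (b :- a) :* (d :- c)) refl P₄ P₀ P₁ P₃ ⟩
        (P₀ - P₄) * (P₃ - P₁)
          ≈⟨ e₀ ⟩
        B * (A₁ * (P₄ - P₃))
          ≈⟨ *-congˡ (*-congˡ h₄) ⟨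
        B * (A₁ * (r * A₄))
          ≈⟨ solve 4 (λ a b r B → B :* (a :* (r :* b)) := a :* b :* (B :* r)) refl A₁ A₄ r B ⟩
        A₁ * A₄ * (B * r) ∎)

      y₅≈Bs : y₅ ≈ B * s
      y₅≈Bs = *-cancelˡ (*-≉0 A₂≉0 A₅≉0) (begin
        A₂ * A₅ * y₅
          ≈⟨ solve 3 (λ a b y → a :* b :* y := a :* (y :* b)) refl A₂ A₅ y₅ ⟩
        A₂ * (y₅ * A₅)
          ≈⟨ *-congˡ h₅ ⟩
        (P₂ - P₀) * (P₅ - P₃)
          ≈⟨ e₂ ⟩
        B * ((P₃ - P₂) * (P₀ - P₅))
          ≈⟨ *-congˡ (solve 4 (λ a b c d → (a :- b) :* (c :- d) := (b :- a) :* (d :- c)) refl P₃ P₂ P₀ P₅) ⟩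
        B * ((P₂ - P₃) * A₅)
          ≈⟨ *-congˡ (*-congʳ h₂) ⟨
        B * (s * A₂ * A₅)
          ≈⟨ solve 4 (λ a b r B → B :* (r :* a :* b) := a :* b :* (B :* r)) refl A₂ A₅ s B ⟩
        A₂ * A₅ * (B * s) ∎)

      q₁₅ : B * (r - s) * (A₁ * A₅) ≈ (P₃ - P₀) * (P₁ - P₅)
      q₁₅ = trans (*-congʳ (trans (solve 3 (λ B r s → B :* (r :- s) := B :* r :- B :* s) refl B r s)
              (+-cong (sym y₁≈Br) (-‿cong (sym y₅≈Bs)))))
            (difference-of-quotients P₀ P₃ h₁ h₅)

      q₄₂ : (r - s) * (A₄ * A₂) ≈ (P₃ - P₀) * (P₄ - P₂)
      q₄₂ = difference-of-quotients P₀ P₃ h₄ h₂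

      q₂₁ : (s - B * r) * (A₂ * A₁) ≈ (P₃ - P₀) * (P₂ - P₁)
      q₂₁ = trans (*-congʳ (+-congˡ (-‿cong (sym y₁≈Br)))) (difference-of-quotients P₀ P₃ h₂ h₁)

      q₅₄ : (B * s - r) * (A₅ * A₄) ≈ (P₃ - P₀) * (P₅ - P₄)
      q₅₄ = trans (*-congʳ (+-congʳ (sym y₅≈Bs))) (difference-of-quotients P₀ P₃ h₅ h₄)

      AAAA≉0 : ¬ (B * (A₁ * A₅ * (A₄ * A₂)) ≈ 0#)
      AAAA≉0 = *-≉0 B≉0 (*-≉0 (*-≉0 A₁≉0 A₅≉0) (*-≉0 A₄≉0 A₂≉0))

      D = P₃ - P₀

      -- This is `e₁` after the Möbius map, with `P₁`, `P₂`, `P₄`, `P₅` at Br, s, r, Bs. In terms of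
      -- z = s/r it reads (1 - B)(z² - (B + 1)z + 1) = 0; multiplied by u, the factor 1 - B becomes
      -- -(u - 1)².
      quadratic : (r - s) * (r - s) ≈ (s - B * r) * (B * s - r)
      quadratic = *-cancelˡ AAAA≉0 (begin
        B * (A₁ * A₅ * (A₄ * A₂)) * ((r - s) * (r - s))
          ≈⟨ solve 4 (λ B r a b → B :* (a :* b) :* (r :* r) := B :* r :* a :* (r :* b)) refl B (r - s) (A₁ * A₅) (A₄ * A₂) ⟩
        B * (r - s) * (A₁ * A₅) * ((r - s) * (A₄ * A₂))
          ≈⟨ *-cong q₁₅ q₄₂ ⟩
        D * (P₁ - P₅) * (D * (P₄ - P₂))
          ≈⟨ solve 3 (λ D a b → D :* a :* (D :* b) := D :* D :* (a :* b)) refl D (P₁ - P₅) (P₄ - P₂) ⟩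
        D * D * ((P₁ - P₅) * (P₄ - P₂))
          ≈⟨ *-congˡ e₁ ⟩
        D * D * (B * ((P₂ - P₁) * (P₅ - P₄)))
          ≈⟨ solve 4 (λ D B a b → D :* D :* (B :* (a :* b)) := B :* (D :* a :* (D :* b))) refl D B (P₂ - P₁) (P₅ - P₄) ⟩
        B * (D * (P₂ - P₁) * (D * (P₅ - P₄)))
          ≈⟨ *-congˡ (*-cong q₂₁ q₅₄) ⟨
        B * ((s - B * r) * (A₂ * A₁) * ((B * s - r) * (A₅ * A₄)))
          ≈⟨ solve 7 (λ B x y a b c d → B :* (x :* (a :* b) :* (y :* (c :* d))) := B :* (b :* c :* (d :* a)) :* (x :* y))
               refl B (s - B * r) (B * s - r) A₂ A₁ A₅ A₄ ⟩
        B * (A₁ * A₅ * (A₄ * A₂)) * ((s - B * r) * (B * s - r)) ∎)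

      -- Since uB = u² − u + 1, the quadratic relation factors over the fixed field.
      factored : (u - 1#) * (u - 1#) * ((s - u * r) * (u * s - r)) ≈ 0#
      factored = begin
        (u - 1#) * (u - 1#) * ((s - u * r) * (u * s - r))
          ≈⟨ solve 3 (λ u r s → (u :- con (+ 1)) :* (u :- con (+ 1)) :* ((s :- u :* r) :* (u :* s :- r)) :=
               let v = u :* u :+ con (+ 1) :- u in
               (u :* s :- v :* r) :* (v :* s :- u :* r) :- u :* u :* ((r :- s) :* (r :- s))) refl u r s ⟩
        (u * s - (u * u + 1# - u) * r) * ((u * u + 1# - u) * s - u * r) - u * u * ((r - s) * (r - s))
          ≈⟨ +-congʳ (*-cong (+-congˡ (-‿cong (*-congʳ Bu))) (+-congʳ (*-congʳ Bu))) ⟨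
        (u * s - (B * u) * r) * ((B * u) * s - u * r) - u * u * ((r - s) * (r - s))
          ≈⟨ solve 4 (λ u r s B → (u :* s :- (B :* u) :* r) :* ((B :* u) :* s :- u :* r) :- u :* u :* ((r :- s) :* (r :- s)) :=
               u :* u :* ((s :- B :* r) :* (B :* s :- r) :- (r :- s) :* (r :- s))) refl u r s B ⟩
        u * u * ((s - B * r) * (B * s - r) - (r - s) * (r - s))
          ≈⟨ *-congˡ (x≈y⇒x-y≈0 (sym quadratic)) ⟩
        u * u * 0#
          ≈⟨ zeroʳ _ ⟩
        0# ∎

      u≉1 : ¬ (u ≈ 1#)
      u≉1 u≈1 = u²≉1 (trans (*-cong u≈1 u≈1) (*-identityʳ 1#))

      q₄₅ : (r - B * s) * (A₄ * A₅) ≈ D * (P₄ - P₅)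
      q₄₅ = trans (*-congʳ (+-congˡ (-‿cong (sym y₅≈Bs)))) (difference-of-quotients P₀ P₃ h₄ h₅)

      -- The ratio s/r is a cross-ratio of `P₂`, `P₄`, `P₃`, `P₀`, so its image under σ is the same
      -- cross-ratio of `P₃`, `P₅`, `P₄`, `P₁`. These sit at 0, Bs, r, Br, which makes the image (r
      -- - s)/(r - Bs). If s/r equals the fixed quotient n/m, so does its image.
      σ-relation : ∀ {m n} → σ m ≈ m → σ n ≈ n → m * s ≈ n * r → m * (r - s) ≈ n * (r - B * s)
      σ-relation {m} {n} σm σn ms≈nr =
        *-cancelˡ (*-≉0 (*-≉0 B≉0 r≉0) (*-≉0 (*-≉0 A₁≉0 A₅≉0) (*-≉0 A₄≉0 A₁≉0))) (begin
          B * r * (A₁ * A₅ * (A₄ * A₁)) * (m * (r - s))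
            ≈⟨ solve 7 (λ B r x m a b c → B :* r :* (a :* b :* (c :* a)) :* (m :* x) :=
                 m :* ((r :* c) :* (B :* x :* (a :* b)) :* a)) refl B r (r - s) m A₁ A₅ A₄ ⟩
          m * ((r * A₄) * (B * (r - s) * (A₁ * A₅)) * A₁)
            ≈⟨ *-congˡ (*-congʳ (*-cong h₄ q₁₅)) ⟩
          m * ((P₄ - P₃) * (D * (P₁ - P₅)) * A₁)
            ≈⟨ solve 7 (λ m p₄ p₃ D p₁ p₅ a → m :* ((p₄ :- p₃) :* (D :* (p₁ :- p₅)) :* a) :=
                 D :* a :* (m :* ((p₃ :- p₄) :* (p₅ :- p₁)))) refl m P₄ P₃ D P₁ P₅ A₁ ⟩
          D * A₁ * (m * ((P₃ - P₄) * (P₅ - P₁)))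
            ≈⟨ *-congˡ at-points ⟩
          D * A₁ * (n * ((P₅ - P₄) * (P₃ - P₁)))
            ≈⟨ solve 7 (λ n p₄ p₃ D p₁ p₅ a → D :* a :* (n :* ((p₅ :- p₄) :* (p₃ :- p₁))) :=
                 n :* (a :* (p₁ :- p₃) :* (D :* (p₄ :- p₅)))) refl n P₄ P₃ D P₁ P₅ A₁ ⟩
          n * (A₁ * (P₁ - P₃) * (D * (P₄ - P₅)))
            ≈⟨ *-congˡ (*-cong (*-congˡ (trans (*-congʳ (sym y₁≈Br)) h₁)) q₄₅) ⟨
          n * (A₁ * (B * r * A₁) * ((r - B * s) * (A₄ * A₅)))
            ≈⟨ solve 7 (λ B r x n a b c → n :* (a :* (B :* r :* a) :* (x :* (c :* b))) :=
                 B :* r :* (a :* b :* (c :* a)) :* (n :* x)) refl B r (r - B * s) n A₁ A₅ A₄ ⟩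
          B * r * (A₁ * A₅ * (A₄ * A₁)) * (n * (r - B * s)) ∎)
        where
        at-points₀ : m * ((P₂ - P₃) * (P₄ - P₀)) ≈ n * ((P₄ - P₃) * (P₂ - P₀))
        at-points₀ = begin
          m * ((P₂ - P₃) * A₄)   ≈⟨ *-congˡ (*-congʳ h₂) ⟨
          m * (s * A₂ * A₄)      ≈⟨ solve 4 (λ m s a b → m :* (s :* a :* b) := m :* s :* (a :* b)) refl m s A₂ A₄ ⟩
          m * s * (A₂ * A₄)      ≈⟨ *-congʳ ms≈nr ⟩
          n * r * (A₂ * A₄)      ≈⟨ solve 4 (λ n r a b → n :* r :* (a :* b) := n :* (r :* b :* a)) refl n r A₂ A₄ ⟩
          n * (r * A₄ * A₂)      ≈⟨ *-congˡ (*-congʳ h₄) ⟩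
          n * ((P₄ - P₃) * A₂)   ∎

        at-points : m * ((P₃ - P₄) * (P₅ - P₁)) ≈ n * ((P₅ - P₄) * (P₃ - P₁))
        at-points = σ-step σm σn at-points₀

      -- For s = ur the image relation says (r - s) - u(r - Bs) = 0. Substituting Bu = u² - u + 1
      -- turns the left side into r(u - 1)(u² - 1), which is nonzero.
      s≉ur : ¬ (s - u * r ≈ 0#)
      s≉ur s-ur≈0 = *-≉0 r≉0 (*-≉0 (x-y≉0 u≉1) (x-y≉0 u²≉1)) (begin
        r * ((u - 1#) * (u * u - 1#))
          ≈⟨ solve 2 (λ r u → r :* ((u :- con (+ 1)) :* (u :* u :- con (+ 1))) :=
               con (+ 1) :* (r :- u :* r) :- (u :* r :- (u :* u :+ con (+ 1) :- u) :* (u :* r))) refl r u ⟩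
        1# * (r - u * r) - (u * r - (u * u + 1# - u) * (u * r))
          ≈⟨ +-congˡ (-‿cong (+-congˡ (-‿cong (*-congʳ Bu)))) ⟨
        1# * (r - u * r) - (u * r - B * u * (u * r))
          ≈⟨ solve 4 (λ x r u B → con (+ 1) :* (r :- x) :- (u :* r :- B :* u :* x) :=
               con (+ 1) :* (r :- x) :- u :* (r :- B :* x)) refl (u * r) r u B ⟩
        1# * (r - u * r) - u * (r - B * (u * r))
          ≈⟨ +-cong (*-congˡ (+-congˡ (-‿cong s≈ur))) (-‿cong (*-congˡ (+-congˡ (-‿cong (*-congˡ s≈ur))))) ⟨
        1# * (r - s) - u * (r - B * s)
          ≈⟨ x≈y⇒x-y≈0 (σ-relation 1#-homo σu (trans (*-identityˡ s) s≈ur)) ⟩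
        0# ∎)
        where s≈ur = x-y≈0⇒x≈y _ _ s-ur≈0

      -- The other root, z = 1/u. Multiplying the image relation by u² clears the denominators and
      -- gives the same nonzero product.
      us≉r : ¬ (u * s - r ≈ 0#)
      us≉r us-r≈0 = *-≉0 r≉0 (*-≉0 (x-y≉0 u≉1) (x-y≉0 u²≉1)) (begin
        r * ((u - 1#) * (u * u - 1#))
          ≈⟨ solve 2 (λ r u → r :* ((u :- con (+ 1)) :* (u :* u :- con (+ 1))) :=
               u :* u :* (u :* r :- r) :- (u :* u :* r :- (u :* u :+ con (+ 1) :- u) :* r)) refl r u ⟩
        u * u * (u * r - r) - (u * u * r - (u * u + 1# - u) * r)
          ≈⟨ +-congˡ (-‿cong (+-congˡ (-‿cong (*-congʳ Bu)))) ⟨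
        u * u * (u * r - r) - (u * u * r - B * u * r)
          ≈⟨ +-cong (*-congˡ (+-congˡ (-‿cong us≈r))) (-‿cong (+-congˡ (-‿cong (*-congˡ us≈r)))) ⟨
        u * u * (u * r - u * s) - (u * u * r - B * u * (u * s))
          ≈⟨ solve 4 (λ r s u B → u :* u :* (u :* r :- u :* s) :- (u :* u :* r :- B :* u :* (u :* s)) :=
               u :* u :* (u :* (r :- s) :- con (+ 1) :* (r :- B :* s))) refl r s u B ⟩
        u * u * (u * (r - s) - 1# * (r - B * s))
          ≈⟨ *-congˡ (x≈y⇒x-y≈0 (σ-relation σu 1#-homo (trans us≈r (sym (*-identityˡ r))))) ⟩
        u * u * 0#
          ≈⟨ zeroʳ _ ⟩
        0# ∎)
        where us≈r = x-y≈0⇒x≈y _ _ us-r≈0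

      conclusion : ⊥
      conclusion = *-≉0 (*-≉0 (x-y≉0 u≉1) (x-y≉0 u≉1)) (*-≉0 s≉ur us≉r) factored

    -- Equality is not assumed decidable here, hence the double negation; over a finite field it can
    -- be removed. The norm B = b σ(b) is fixed by σ because σ² b = b.
    kernel⇒fixed : (∀ x → σ (σ (σ (σ (σ (σ x))))) ≈ x) → ∀ {u b} → σ u ≈ u → σ (σ b) ≈ b →
      ¬ (u * u ≈ 1#) → ¬ (b ≈ 0#) → b * σ b * u ≈ u * u + 1# - u →
      ∀ {x t} → ¬ (x ≈ 0#) →
      x * (b * σ (t * x) + σ (σ (σ (σ (t * x))))) ≈ (t * x) * (b * σ x + σ (σ (σ (σ x)))) →
      ¬ ¬ (σ t ≈ t)
    kernel⇒fixed σ⁶ {u} {b} σu σ²b u²≉1 b≉0 Bu {x} {t} x≉0 kernel σt≉t =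
      no-cross-ratio σu σB u²≉1 (*-≉0 b≉0 (σ-≉0 b≉0)) Bu (σ⁶ t) σt≉t cross-ratio
      where
      σ-≉0 : ∀ {y} → ¬ (y ≈ 0#) → ¬ (σ y ≈ 0#)
      σ-≉0 y≉0 σy≈0 = y≉0 (trans (sym (σ⁶ _)) (trans (σ⁵-cong σy≈0) σ⁵0))
        where
        σ⁵-cong : ∀ {v w} → v ≈ w → σ (σ (σ (σ (σ v)))) ≈ σ (σ (σ (σ (σ w))))
        σ⁵-cong e = ⟦⟧-cong (⟦⟧-cong (⟦⟧-cong (⟦⟧-cong (⟦⟧-cong e))))
        0-step : ∀ {y} → y ≈ 0# → σ y ≈ 0#
        0-step e = trans (⟦⟧-cong e) 0#-homo
        σ⁵0 : σ (σ (σ (σ (σ 0#)))) ≈ 0#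
        σ⁵0 = 0-step (0-step (0-step (0-step 0#-homo)))

      σB : σ (b * σ b) ≈ b * σ b
      σB = trans (*-homo b (σ b)) (trans (*-congˡ σ²b) (*-comm (σ b) b))

      x₁ = σ x
      x₄ = σ (σ (σ x₁))
      t₁ = σ t
      t₃ = σ (σ t₁)
      t₄ = σ t₃

      σ-** : ∀ y z w → σ (y * z * w) ≈ σ y * σ z * σ w
      σ-** y z w = trans (*-homo (y * z) w) (*-congʳ (*-homo y z))

      -- The factor `1#` gives both sides the shape that `step` transports along σ.
      linear : b * x₁ * (t₁ - t) ≈ 1# * x₄ * (t - t₄)
      linear = x-y≈0⇒x≈y _ _ (trans
        (solve 6 (λ b x₁ x₄ t t₁ t₄ → b :* x₁ :* (t₁ :- t) :- con (+ 1) :* x₄ :* (t :- t₄) :=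
           (b :* (t₁ :* x₁) :+ t₄ :* x₄) :- t :* (b :* x₁ :+ x₄)) refl b x₁ x₄ t t₁ t₄)
        (x≈y⇒x-y≈0 (*-cancelˡ x≉0 (begin
          x * (b * (t₁ * x₁) + t₄ * x₄)                       ≈⟨ *-congˡ (+-cong (*-congˡ (*-homo t x)) σ⁴) ⟨
          x * (b * σ (t * x) + σ (σ (σ (σ (t * x)))))         ≈⟨ kernel ⟩
          (t * x) * (b * x₁ + x₄)                             ≈⟨ *-congʳ (*-comm t x) ⟩
          (x * t) * (b * x₁ + x₄)                             ≈⟨ *-assoc x t _ ⟩
          x * (t * (b * x₁ + x₄))                             ∎))))
        where
        σ⁴ : σ (σ (σ (σ (t * x)))) ≈ t₄ * x₄
        σ⁴ = trans (⟦⟧-cong (trans (⟦⟧-cong (trans (⟦⟧-cong (*-homo t x)) (*-homo _ _))) (*-homo _ _))) (*-homo _ _)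

      step : ∀ {m n y z a b c d} → m * y * (a - b) ≈ n * z * (c - d) →
        σ m * σ y * (σ a - σ b) ≈ σ n * σ z * (σ c - σ d)
      step eq = trans (sym (trans (σ-** _ _ _) (*-congˡ (σ-‿- _ _))))
        (trans (⟦⟧-cong eq) (trans (σ-** _ _ _) (*-congˡ (σ-‿- _ _))))

      -- The third image is the useful one: by σ⁶ = 1, the map σ³ exchanges `x₁` and `x₄`, so
      -- multiplying by `linear` puts the same factor `x₁ * x₄` on both sides. Also σ³ b = σ b.
      linear₃ : σ b * x₄ * (t₄ - t₃) ≈ 1# * x₁ * (t₃ - t₁)
      linear₃ = begin
        σ b * x₄ * (t₄ - t₃)                   ≈⟨ *-congʳ (*-congʳ (⟦⟧-cong σ²b)) ⟨
        σ (σ (σ b)) * x₄ * (t₄ - t₃)           ≈⟨ step (step (step linear)) ⟩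
        σ (σ (σ 1#)) * σ (σ (σ x₄)) * (t₃ - σ (σ (σ t₄)))
          ≈⟨ *-cong (*-cong (trans (⟦⟧-cong (trans (⟦⟧-cong 1#-homo) 1#-homo)) 1#-homo) (σ⁶ x₁)) (+-congˡ (-‿cong (σ⁶ t₁))) ⟩
        1# * x₁ * (t₃ - t₁)                    ∎

      x₁≉0 = σ-≉0 x≉0
      x₄≉0 = σ-≉0 (σ-≉0 (σ-≉0 x₁≉0))

      cross-ratio : (t - t₄) * (t₃ - t₁) ≈ b * σ b * ((t₁ - t) * (t₄ - t₃))
      cross-ratio = *-cancelˡ (*-≉0 x₁≉0 x₄≉0) (begin
        x₁ * x₄ * ((t - t₄) * (t₃ - t₁))
          ≈⟨ solve 4 (λ x y a b → x :* y :* (a :* b) := (con (+ 1) :* y :* a) :* (con (+ 1) :* x :* b)) refl x₁ x₄ (t - t₄) (t₃ - t₁) ⟩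
        (1# * x₄ * (t - t₄)) * (1# * x₁ * (t₃ - t₁))
          ≈⟨ *-cong linear linear₃ ⟨
        (b * x₁ * (t₁ - t)) * (σ b * x₄ * (t₄ - t₃))
          ≈⟨ solve 6 (λ b c x y a d → (b :* x :* a) :* (c :* y :* d) := x :* y :* (b :* c :* (a :* d))) refl b (σ b) x₁ x₄ (t₁ - t) (t₄ - t₃) ⟩
        x₁ * x₄ * (b * σ b * ((t₁ - t) * (t₄ - t₃))) ∎)

-- Finite fields: decidable equality and sums over all elements

module _ {c ℓ} (M : CommutativeMonoid c ℓ) where
  open CommutativeMonoid M
  open MonoidSum M
  open SetoidReasoning setoid

  sum-concentrated : ∀ {n} i (t : Fin n → Carrier) → (∀ j → ¬ (j ≡ i) → t j ≈ ε) → sum t ≈ t i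
  sum-concentrated {suc n} i t t≈ε = begin
    sum t                         ≈⟨ sum-remove t ⟩
    t i ∙ sum (λ j → t (punchIn i j))
      ≈⟨ ∙-congˡ (sum-cong-≋ {n} (λ j → t≈ε (punchIn i j) (Fin.punchInᵢ≢i i j))) ⟩
    t i ∙ sum {n} (λ _ → ε)       ≈⟨ ∙-congˡ (sum-replicate-zero n) ⟩
    t i ∙ ε                       ≈⟨ identityʳ (t i) ⟩
    t i                           ∎

module FiniteField {c ℓ} (K : Field c ℓ) {n} (order : HasOrder K n) where
  open Field K hiding (zero)
  open FieldProperties K
  open Exp commutativeSemiring using (_^_; ^-congˡ)
  open SemiringMult semiring using () renaming (_×_ to _×ₙ_)
  open SetoidReasoning setoid
  private module E = Inverse order

  element : Fin n → Carrier
  element = E.to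

  index : Carrier → Fin n
  index = E.from

  index-cong : ∀ {x y} → x ≈ y → index x ≡ index y
  index-cong = E.from-cong

  element-index : ∀ x → element (index x) ≈ x
  element-index = E.strictlyInverseˡ

  index-element : ∀ i → index (element i) ≡ i
  index-element = E.strictlyInverseʳ

  index-injective : ∀ {x y} → index x ≡ index y → x ≈ y
  index-injective {x} {y} eq = trans (sym (element-index x)) (trans (reflexive (≡.cong element eq)) (element-index y))

  element-injective : ∀ {i j} → element i ≈ element j → i ≡ j
  element-injective {i} {j} eq = ≡.trans (≡.sym (index-element i)) (≡.trans (index-cong eq) (index-element j))

  infix 4 _≟_
  _≟_ : Decidable _≈_
  x ≟ y = map′ index-injective index-cong (index x Fin.≟ index y)

  ∃? : ∀ {p} {P : Carrier → Set p} → (∀ {x y} → x ≈ y → P x → P y) →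
       (∀ x → Dec (P x)) → Dec (∃ P)
  ∃? resp P? = map′ (λ (i , p) → element i , p)
                    (λ (x , p) → index x , resp (sym (element-index x)) p)
                    (Fin.any? (λ i → P? (element i)))

  module _ (f g : Carrier → Carrier)
           (f-cong : ∀ {x y} → x ≈ y → f x ≈ f y) (g-cong : ∀ {x y} → x ≈ y → g x ≈ g y)
           (f-g : ∀ x → f (g x) ≈ x) (g-f : ∀ x → g (f x) ≈ x) where
    bijection⇒permutation : Permutation n n
    bijection⇒permutation = permutation
      (λ i → index (f (element i))) (λ i → index (g (element i)))
      (λ i → ≡.trans (index-cong (trans (f-cong (element-index _)) (f-g _))) (index-element i))
      (λ i → ≡.trans (index-cong (trans (g-cong (element-index _)) (g-f _))) (index-element i))

    module _ {c′ ℓ′} (M : CommutativeMonoid c′ ℓ′) where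
      private module M = CommutativeMonoid M
      open MonoidSum M

      sum-reindex : (h : Carrier → M.Carrier) → (∀ {x y} → x ≈ y → h x M.≈ h y) →
                    sum (λ i → h (element i)) M.≈ sum (λ i → h (f (element i)))
      sum-reindex h h-cong = M.trans (sum-permute (λ i → h (element i)) bijection⇒permutation)
        (sum-cong-≋ (λ i → h-cong (element-index (f (element i)))))

  -- Translation by 1 permutes the field, so the sum S of all elements satisfies S = S + n · 1.
  order×1≈0 : n ×ₙ 1# ≈ 0#
  order×1≈0 = sym (+-cancel (begin
    S + 0#                                 ≈⟨ +-identityʳ S ⟩
    S                                      ≈⟨ sum-reindex (_+ 1#) (_- 1#) +-congʳ +-congʳ inv₁ inv₂
                                                +-commutativeMonoid (λ x → x) (λ e → e) ⟩
    ∑[ i < n ] (element i + 1#)            ≈⟨ ∑-distrib-+ element (λ _ → 1#) ⟩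
    S + ∑[ i < n ] 1#                      ≈⟨ +-congˡ (sum-replicate n) ⟩
    S + n ×ₙ 1#                             ∎))
    where
    open MonoidSum +-commutativeMonoid
    open IntegerSolver commutativeRing
    S = sum element
    +-cancel : ∀ {x y z} → x + y ≈ x + z → y ≈ z
    +-cancel {x} {y} {z} = GroupProperties.∙-cancelˡ +-group x y z
    inv₁ : ∀ x → (x - 1#) + 1# ≈ x
    inv₁ = solve 1 (λ x → (x :- con (+ 1)) :+ con (+ 1) := x) refl
    inv₂ : ∀ x → (x + 1#) - 1# ≈ x
    inv₂ = solve 1 (λ x → (x :+ con (+ 1)) :- con (+ 1) := x) refl

  private module Π = MonoidSum *-commutativeMonoid

  ∏-≉0 : ∀ {m} (t : Fin m → Carrier) → (∀ i → ¬ (t i ≈ 0#)) → ¬ (Π.sum t ≈ 0#)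
  ∏-≉0 {zero}  t t≉0 = 1≉0
  ∏-≉0 {suc m} t t≉0 = *-≉0 (t≉0 zero) (∏-≉0 (λ i → t (suc i)) (λ i → t≉0 (suc i)))

  -- Replacing 0 by 1 and comparing the products over all x and over all a x
  -- leaves one factor a, at x = 0.
  x^order≈x : ∀ x → x ^ n ≈ x
  x^order≈x a with a ≟ 0#
  ... | yes a≈0 = trans (^-congˡ n a≈0) (trans (0^ n {{Fin.nonZeroIndex (index a)}}) (sym a≈0))
  ... | no  a≉0 with b , ab≈1 ← inverses a a≉0 = *-cancelˡ (∏-≉0 _ (λ i → unit-≉0 (element i))) (begin
    P * a ^ n                                      ≈⟨ *-comm P (a ^ n) ⟩
    a ^ n * P                                      ≈⟨ *-congʳ (Π.sum-replicate n) ⟨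
    Π.sum {n} (λ _ → a) * P                        ≈⟨ Π.∑-distrib-+ (λ _ → a) (λ i → unit (element i)) ⟨
    Π.sum (λ i → a * unit (element i))             ≈⟨ Π.sum-cong-≋ (λ i → a*unit (element i)) ⟩
    Π.sum (λ i → unit (a * element i) * k (element i))
      ≈⟨ Π.∑-distrib-+ (λ i → unit (a * element i)) (λ i → k (element i)) ⟩
    Π.sum (λ i → unit (a * element i)) * Π.sum (λ i → k (element i))
      ≈⟨ *-cong (sym (sum-reindex (a *_) (b *_) *-congˡ *-congˡ (inv ab≈1) (inv (trans (*-comm b a) ab≈1))
                   *-commutativeMonoid unit unit-cong))
                (trans (sum-concentrated *-commutativeMonoid (index 0#) (λ i → k (element i)) k≈1) k≈a) ⟩
    P * a ∎)
    where
    unit : Carrier → Carrier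
    unit x with x ≟ 0#
    ... | yes _ = 1#
    ... | no  _ = x

    unit-≉0 : ∀ x → ¬ (unit x ≈ 0#)
    unit-≉0 x with x ≟ 0#
    ... | yes _  = 1≉0
    ... | no x≉0 = x≉0

    unit-cong : ∀ {x y} → x ≈ y → unit x ≈ unit y
    unit-cong {x} {y} x≈y with x ≟ 0# | y ≟ 0#
    ... | yes _   | yes _   = refl
    ... | yes x≈0 | no y≉0  = contradiction (trans (sym x≈y) x≈0) y≉0
    ... | no x≉0  | yes y≈0 = contradiction (trans x≈y y≈0) x≉0
    ... | no _    | no _    = x≈y

    k : Carrier → Carrier
    k x with x ≟ 0#
    ... | yes _ = a
    ... | no  _ = 1#

    a*unit : ∀ x → a * unit x ≈ unit (a * x) * k x
    a*unit x with x ≟ 0# | a * x ≟ 0#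
    ... | yes _   | yes _    = *-comm a 1#
    ... | yes x≈0 | no ax≉0  = contradiction (trans (*-congˡ x≈0) (zeroʳ a)) ax≉0
    ... | no x≉0  | yes ax≈0 = contradiction ax≈0 (*-≉0 a≉0 x≉0)
    ... | no _    | no _     = sym (*-identityʳ (a * x))

    k≈a : k (element (index 0#)) ≈ a
    k≈a with element (index 0#) ≟ 0#
    ... | yes _ = refl
    ... | no ≉0 = contradiction (element-index 0#) ≉0

    k≈1 : ∀ j → ¬ (j ≡ index 0#) → k (element j) ≈ 1#
    k≈1 j j≢ with element j ≟ 0#
    ... | yes ≈0 = contradiction (≡.trans (≡.sym (index-element j)) (index-cong ≈0)) j≢
    ... | no  _  = refl

    P = Π.sum (λ i → unit (element i))

    inv : ∀ {y z} → y * z ≈ 1# → ∀ x → y * (z * x) ≈ x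
    inv {y} {z} yz≈1 x = trans (sym (*-assoc y z x)) (trans (*-congʳ yz≈1) (*-identityˡ x))

-- Binomial coefficients modulo p and additivity of Frobenius

prime∤! : ∀ {p} → Prime p → ∀ k → k ℕ.< p → ¬ (p ∣ k ℕ.!)
prime∤! pr zero    k<p p∣1 = ¬prime[1] (≡.subst Prime (ℕ.≤-antisym (∣⇒≤ p∣1) k<p) pr)
prime∤! pr (suc k) k<p p∣k! with euclidsLemma (suc k) (k ℕ.!) pr p∣k!
... | inj₁ p∣k+1 = ℕ.<⇒≱ k<p (∣⇒≤ p∣k+1)
... | inj₂ p∣k!′ = prime∤! pr k (ℕ.<-trans (ℕ.n<1+n k) k<p) p∣k!′

C*k![n∸k]!≡n! : ∀ {n k} → k ℕ.≤ n → (n C k) ℕ.* (k ℕ.! ℕ.* (n ℕ.∸ k) ℕ.!) ≡ n ℕ.!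
C*k![n∸k]!≡n! {n} {k} k≤n = ≡.trans
  (≡.cong (ℕ._* (k ℕ.! ℕ.* (n ℕ.∸ k) ℕ.!)) (nCk≡n!/k![n-k]! k≤n))
  (m/n*n≡m {{k !* (n ℕ.∸ k) !≢0}} (k![n∸k]!∣n! k≤n))

prime∣C : ∀ {p} → Prime p → ∀ k → 0 ℕ.< k → k ℕ.< p → p ∣ p C k
prime∣C {p@(suc p-1)} pr k 0<k k<p
  with euclidsLemma (p C k) (k ℕ.! ℕ.* (p ℕ.∸ k) ℕ.!) pr
         (≡.subst (p ∣_) (≡.sym (C*k![n∸k]!≡n! (ℕ.<⇒≤ k<p))) (m∣m*n (p-1 ℕ.!)))
... | inj₁ p∣C = p∣C
... | inj₂ p∣k![p-k]! with euclidsLemma (k ℕ.!) ((p ℕ.∸ k) ℕ.!) pr p∣k![p-k]!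
...   | inj₁ p∣k! = contradiction p∣k! (prime∤! pr k k<p)
...   | inj₂ p∣[p-k]! = contradiction p∣[p-k]! (prime∤! pr (p ℕ.∸ k) (ℕ.∸-monoʳ-< 0<k (ℕ.<⇒≤ k<p)))

module Frobenius {c ℓ} (K : Field c ℓ) {p} (p-prime : Prime p) where
  open Field K hiding (zero)
  open SemiringMult semiring renaming (_×_ to _×ₙ_)
  open Exp commutativeSemiring using (_^_; ^-congˡ; ^-assocʳ)
  open MonoidSum +-commutativeMonoid
  open SetoidReasoning setoid

  module _ (p×1≈0 : p ×ₙ 1# ≈ 0#) where

    p∣m⇒m×x≈0 : ∀ {m} → p ∣ m → ∀ x → m ×ₙ x ≈ 0#
    p∣m⇒m×x≈0 {m} (divides d m≡dp) x = begin
      m ×ₙ x                       ≡⟨ ≡.cong (_×ₙ x) (≡.trans m≡dp (ℕ.*-comm d p)) ⟩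
      (p ℕ.* d) ×ₙ x               ≈⟨ ×-assocˡ x p d ⟨
      p ×ₙ (d ×ₙ x)                ≈⟨ ×-congʳ p (*-identityˡ _) ⟨
      p ×ₙ (1# * (d ×ₙ x))         ≈⟨ ×-assoc-* p 1# _ ⟨
      (p ×ₙ 1#) * (d ×ₙ x)         ≈⟨ *-congʳ p×1≈0 ⟩
      0# * (d ×ₙ x)                ≈⟨ zeroˡ _ ⟩
      0#                           ∎

    [x+y]^p : ∀ x y → (x + y) ^ p ≈ x ^ p + y ^ p
    [x+y]^p x y = expand p ≡.refl
      where
      -- The exponent is decoupled from p so that it can be matched as a successor, as the splitting
      -- off of the first and last binomial terms requires.
      expand : ∀ n → p ≡ n → (x + y) ^ n ≈ x ^ n + y ^ n
      expand zero    p≡ = contradiction (≡.subst Prime p≡ p-prime) ¬prime[0]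
      expand (suc m) p≡ = begin
        (x + y) ^ suc m            ≈⟨ Binomial.theorem commutativeSemiring (suc m) x y ⟩
        t zero + sum (λ i → t (suc i))
          ≈⟨ +-cong t₀≈ (trans (sum-init-last (λ i → t (suc i))) (+-cong middle tₘ≈)) ⟩
        y ^ suc m + (0# + x ^ suc m)   ≈⟨ +-congˡ (+-identityˡ _) ⟩
        y ^ suc m + x ^ suc m          ≈⟨ +-comm _ _ ⟩
        x ^ suc m + y ^ suc m          ∎
        where
        t = Binomial.binomialTerm commutativeSemiring x y (suc m)

        t₀≈ : t zero ≈ y ^ suc m
        t₀≈ = trans (+-identityʳ _) (*-identityˡ _)

        tₘ≈ : t (suc (Fin.fromℕ m)) ≈ x ^ suc m
        tₘ≈ = begin
          t (suc (Fin.fromℕ m))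
            ≡⟨ ≡.cong (λ k → (suc m C suc k) ×ₙ (x ^ suc k * y ^ (m ℕ.∸ k))) (Fin.toℕ-fromℕ m) ⟩
          (suc m C suc m) ×ₙ (x ^ suc m * y ^ (m ℕ.∸ m))
            ≡⟨ ≡.cong₂ (λ k l → k ×ₙ (x ^ suc m * y ^ l)) (nCn≡1 (suc m)) (ℕ.n∸n≡0 m) ⟩
          1 ×ₙ (x ^ suc m * 1#)     ≈⟨ ×-homo-1 _ ⟩
          x ^ suc m * 1#            ≈⟨ *-identityʳ _ ⟩
          x ^ suc m                 ∎

        middle : sum (λ i → t (suc (Fin.inject₁ i))) ≈ 0#
        middle = trans (sum-cong-≋ {m} (λ i → p∣m⇒m×x≈0
          (≡.subst (_∣ suc m C suc (toℕ (Fin.inject₁ i))) (≡.sym p≡)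
            (prime∣C (≡.subst Prime p≡ p-prime) _ ℕ.z<s (ℕ.s<s (Fin.inject₁ℕ< i)))) _))
          (sum-replicate-zero m)

    [x+y]^pᵏ : ∀ k x y → (x + y) ^ (p ℕ.^ k) ≈ x ^ (p ℕ.^ k) + y ^ (p ℕ.^ k)
    [x+y]^pᵏ zero    x y = trans (*-identityʳ _) (sym (+-cong (*-identityʳ x) (*-identityʳ y)))
    [x+y]^pᵏ (suc k) x y = begin
      (x + y) ^ (p ℕ.* p ℕ.^ k)                    ≈⟨ ^-assocʳ (x + y) p (p ℕ.^ k) ⟨
      ((x + y) ^ p) ^ (p ℕ.^ k)                    ≈⟨ ^-congˡ (p ℕ.^ k) ([x+y]^p x y) ⟩
      (x ^ p + y ^ p) ^ (p ℕ.^ k)                  ≈⟨ [x+y]^pᵏ k (x ^ p) (y ^ p) ⟩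
      (x ^ p) ^ (p ℕ.^ k) + (y ^ p) ^ (p ℕ.^ k)    ≈⟨ +-cong (^-assocʳ x p _) (^-assocʳ y p _) ⟩
      x ^ (p ℕ.* p ℕ.^ k) + y ^ (p ℕ.* p ℕ.^ k)    ∎

module _ {c ℓ} (K : Field c ℓ) where
  open Field K hiding (zero)
  open FieldProperties K
  open Exp commutativeSemiring using (_^_; ^-congˡ; ^-distrib-*)
  open SemiringMult semiring using (×-homo-1; ×1-homo-*) renaming (_×_ to _×ₙ_)
  open SetoidReasoning setoid

  power-endomorphism : ∀ q .{{_ : ℕ.NonZero q}} → (∀ x y → (x + y) ^ q ≈ x ^ q + y ^ q) →
                       RingHomomorphism rawRing rawRing
  power-endomorphism q additive = record
    { ⟦_⟧ = _^ q
    ; isRingHomomorphism = record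
      { isSemiringHomomorphism = record
        { isNearSemiringHomomorphism = record
          { +-isMonoidHomomorphism = record
            { isMagmaHomomorphism = record
              { isRelHomomorphism = record { cong = ^-congˡ q }
              ; homo = additive
              }
            ; ε-homo = 0^ q
            }
          ; *-homo = λ x y → ^-distrib-* x y q
          }
        ; 1#-homo = 1^ q
        }
      ; -‿homo = λ x → inverseˡ-unique _ _ (begin
          (- x) ^ q + x ^ q    ≈⟨ additive (- x) x ⟨
          (- x + x) ^ q        ≈⟨ ^-congˡ q (-‿inverseˡ x) ⟩
          0# ^ q               ≈⟨ 0^ q ⟩
          0#                   ∎)
      }
    }
    where
    open GroupProperties +-group using (inverseˡ-unique)
    1^ : ∀ m → 1# ^ m ≈ 1#
    1^ zero    = refl
    1^ (suc m) = trans (*-identityˡ _) (1^ m)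

  private
    [n^k]×1≉0 : ∀ {n} → ¬ (n ×ₙ 1# ≈ 0#) → ∀ k → ¬ ((n ℕ.^ k) ×ₙ 1# ≈ 0#)
    [n^k]×1≉0 n≉0 zero    eq = 1≉0 (trans (sym (×-homo-1 1#)) eq)
    [n^k]×1≉0 {n} n≉0 (suc k) eq = *-≉0 n≉0 ([n^k]×1≉0 {n} n≉0 k) (trans (sym (×1-homo-* n (n ℕ.^ k))) eq)

  -- The order, a power of p, vanishes in K by translation invariance. A field has no nilpotents, so
  -- p itself vanishes in K.
  frobenius-additive : ∀ {q} n → IsPrimePower q → HasOrder K (q ℕ.^ n) →
                       ∀ x y → (x + y) ^ q ≈ x ^ q + y ^ q
  frobenius-additive n (p , k , p-prime , _ , ≡.refl) order with FiniteField._≟_ K order (p ×ₙ 1#) 0#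
  ... | yes p×1≈0 = Frobenius.[x+y]^pᵏ K p-prime p×1≈0 k
  ... | no  p×1≉0 = contradiction (FiniteField.order×1≈0 K order) ([n^k]×1≉0 {p ℕ.^ k} ([n^k]×1≉0 {p} p×1≉0 k) n)

-- Monic polynomial functions and root counting

module MonicPolynomial {c ℓ} (K : Field c ℓ) where
  open Field K hiding (zero)
  open FieldProperties K
  open IntegerSolver commutativeRing
  open Exp commutativeSemiring using (_^_)
  open SetoidReasoning setoid

  -- Polynomial functions, built up by Horner's rule f(x) = a + x g(x).
  data Monic : ℕ → (Carrier → Carrier) → Set (c ⊔ ℓ) where
    unit   : ∀ {f} → (∀ x → f x ≈ 1#) → Monic 0 f
    horner : ∀ {n f g} a → Monic n g → (∀ x → f x ≈ a + x * g x) → Monic (suc n) f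

  -- Synthetic division by x - a: if f(x) = b + x g(x), the quotient has constant term g(a).
  factor : ∀ {n f} → Monic (suc n) f → ∀ a →
           ∃ λ g → Monic n g × (∀ x → f x ≈ (x - a) * g x + f a)
  factor {zero} {f} (horner {g = g} b (unit g≈1) f≈) a = (λ _ → 1#) , unit (λ _ → refl) , λ x → begin
    f x                            ≈⟨ f≈ x ⟩
    b + x * g x                    ≈⟨ +-congˡ (*-congˡ (g≈1 x)) ⟩
    b + x * 1#                     ≈⟨ solve 3 (λ b x a → b :+ x :* con (+ 1) := (x :- a) :* con (+ 1) :+ (b :+ a :* con (+ 1))) refl b x a ⟩
    (x - a) * 1# + (b + a * 1#)    ≈⟨ +-congˡ (trans (f≈ a) (+-congˡ (*-congˡ (g≈1 a)))) ⟨
    (x - a) * 1# + f a             ∎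
  factor {suc n} {f} (horner {g = g} b g-monic f≈) a with h , h-monic , g≈ ← factor g-monic a =
    (λ x → g a + x * h x) , horner (g a) h-monic (λ _ → refl) , λ x → begin
    f x                                       ≈⟨ f≈ x ⟩
    b + x * g x                               ≈⟨ +-congˡ (*-congˡ (g≈ x)) ⟩
    b + x * ((x - a) * h x + g a)
      ≈⟨ solve 5 (λ b x a h g → b :+ x :* ((x :- a) :* h :+ g) := (x :- a) :* (g :+ x :* h) :+ (b :+ a :* g)) refl b x a (h x) (g a) ⟩
    (x - a) * (g a + x * h x) + (b + a * g a) ≈⟨ +-congˡ (f≈ a) ⟨
    (x - a) * (g a + x * h x) + f a           ∎

  too-many-roots : ∀ {n f} → Monic n f → (r : Fin (suc n) → Carrier) →
                   (∀ {i j} → r i ≈ r j → i ≡ j) → ¬ (∀ i → f (r i) ≈ 0#)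
  too-many-roots (unit f≈1) r r-inj roots = 1≉0 (trans (sym (f≈1 _)) (roots zero))
  too-many-roots {suc n} {f} f-monic r r-inj roots with g , g-monic , f≈ ← factor f-monic (r zero) =
    too-many-roots g-monic (λ i → r (suc i)) (λ eq → Fin.suc-injective (r-inj eq)) λ i →
      xy≈0⇒y≈0 (x-y≉0 λ eq → Fin.0≢1+n (≡.sym (r-inj eq))) (begin
        (r (suc i) - r zero) * g (r (suc i))              ≈⟨ +-identityʳ _ ⟨
        (r (suc i) - r zero) * g (r (suc i)) + 0#         ≈⟨ +-congˡ (roots zero) ⟨
        (r (suc i) - r zero) * g (r (suc i)) + f (r zero) ≈⟨ f≈ (r (suc i)) ⟨
        f (r (suc i))                                     ≈⟨ roots (suc i) ⟩
        0#                                                ∎)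

  x^n-monic : ∀ n → Monic n (_^ n)
  x^n-monic zero    = unit (λ _ → refl)
  x^n-monic (suc n) = horner 0# (x^n-monic n) (λ x → sym (+-identityˡ _))

  x^m*-monic : ∀ m {n f} → Monic n f → Monic (m ℕ.+ n) (λ x → x ^ m * f x)
  x^m*-monic zero    {f = f} (unit f≈1)          = unit (λ x → trans (*-identityˡ _) (f≈1 x))
  x^m*-monic zero    {f = f} (horner a g-monic f≈) = horner a g-monic (λ x → trans (*-identityˡ _) (f≈ x))
  x^m*-monic (suc m) f-monic = horner 0# (x^m*-monic m f-monic)
    (λ x → trans (*-assoc _ _ _) (sym (+-identityˡ _)))

  a+-monic : ∀ a {n f} → Monic (suc n) f → Monic (suc n) (λ x → a + f x)
  a+-monic a (horner b g-monic f≈) = horner (a + b) g-monic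
    (λ x → trans (+-congˡ (f≈ x)) (sym (+-assoc _ _ _)))

  x^n-x-monic : ∀ n → Monic (suc (suc n)) (λ x → x ^ suc (suc n) - x)
  x^n-x-monic n = horner 0# (a+-monic (- 1#) (x^n-monic (suc n)))
    (λ x → solve 2 (λ x y → x :* y :- x := con (+ 0) :+ x :* (:- con (+ 1) :+ y)) refl x (x ^ suc n))

  module _ {N} (order : HasOrder K N) where
    open FiniteField K order

    -- If all N elements were roots, the first n + 1 would already be too many; the finite search
    -- turns this refutation into a witness.
    nonroot : ∀ {n f} → Monic n f → n ℕ.< N → (∀ {x y} → x ≈ y → f x ≈ f y) → ∃ λ x → ¬ (f x ≈ 0#)
    nonroot {n} {f} f-monic n<N f-cong with i , fi≉0 ← Fin.¬∀⟶∃¬ N (λ i → f (element i) ≈ 0#) (λ i → f (element i) ≟ 0#)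
        (λ roots → too-many-roots f-monic (λ i → element (Fin.inject≤ i n<N))
          (λ eq → Fin.inject≤-injective n<N n<N _ _ (element-injective eq)) (λ i → roots _))
      = element i , fi≉0

-- Embeddings of finite fields and their images

module FieldEmbedding {c ℓ} (F K : Field c ℓ) (ι : Embedding F K) where
  private
    module F = Field F
    module K = Field K
    module Fₑ = Exp F.commutativeSemiring
    module Kₑ = Exp K.commutativeSemiring
  open RingHomomorphism ι

  ^-homo : ∀ x n → ⟦ x Fₑ.^ n ⟧ K.≈ ⟦ x ⟧ Kₑ.^ n
  ^-homo x zero    = 1#-homo
  ^-homo x (suc n) = K.trans (*-homo x _) (K.*-congˡ (^-homo x n))

  module _ {m} (F-order : HasOrder F m) where
    open FiniteField F F-order

    embedding-≉0 : ∀ {x} → ¬ (x F.≈ F.0#) → ¬ (⟦ x ⟧ K.≈ K.0#)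
    embedding-≉0 {x} x≉0 ιx≈0 with y , xy≈1 ← F.inverses x x≉0 = K.1≉0 (begin
      K.1#              ≈⟨ 1#-homo ⟨
      ⟦ F.1# ⟧          ≈⟨ ⟦⟧-cong xy≈1 ⟨
      ⟦ x F.* y ⟧       ≈⟨ *-homo x y ⟩
      ⟦ x ⟧ K.* ⟦ y ⟧   ≈⟨ K.*-congʳ ιx≈0 ⟩
      K.0# K.* ⟦ y ⟧    ≈⟨ K.zeroˡ _ ⟩
      K.0#              ∎)
      where open SetoidReasoning K.setoid

    embedding-injective : ∀ {x y} → ⟦ x ⟧ K.≈ ⟦ y ⟧ → x F.≈ y
    embedding-injective {x} {y} ιx≈ιy with (x F.- y) ≟ F.0#
    ... | yes x-y≈0 = FieldProperties.x-y≈0⇒x≈y F _ _ x-y≈0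
    ... | no  x-y≉0 = contradiction
      (K.trans (+-homo x (F.- y)) (K.trans (K.+-congˡ (-‿homo y)) (FieldProperties.x≈y⇒x-y≈0 K ιx≈ιy)))
      (embedding-≉0 x-y≉0)

    image-fixed : ∀ x → ⟦ x ⟧ Kₑ.^ m K.≈ ⟦ x ⟧
    image-fixed x = K.trans (K.sym (^-homo x m)) (⟦⟧-cong (x^order≈x x))

    -- The m embedded elements are roots of x^m - x, so a fixed y outside the image would be root
    -- number m + 1. The bound 1 < m makes this polynomial monic of degree m.
    fixed⇒image : ∀ {n} → HasOrder K n → 1 ℕ.< m → ∀ y → y Kₑ.^ m K.≈ y → ∃ λ x → y K.≈ ⟦ x ⟧
    fixed⇒image K-order (ℕ.s<s (ℕ.s≤s {n = n} ℕ.z≤n)) y yᵐ≈y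
      with ∃? (λ e p → K.trans p (⟦⟧-cong e)) (λ x → FiniteField._≟_ K K-order y ⟦ x ⟧)
    ... | yes image = image
    ... | no ¬image = contradiction roots (too-many-roots (x^n-x-monic n) r r-injective)
      where
      open MonicPolynomial K
      r : Fin (suc m) → K.Carrier
      r zero    = y
      r (suc i) = ⟦ element i ⟧

      r-injective : ∀ {i j} → r i K.≈ r j → i ≡ j
      r-injective {zero}  {zero}  _  = ≡.refl
      r-injective {zero}  {suc j} eq = contradiction (_ , eq) ¬image
      r-injective {suc i} {zero}  eq = contradiction (_ , K.sym eq) ¬image
      r-injective {suc i} {suc j} eq = ≡.cong suc (element-injective (embedding-injective eq))

      roots : ∀ i → (r i Kₑ.^ m) K.- r i K.≈ K.0#
      roots zero    = FieldProperties.x≈y⇒x-y≈0 K yᵐ≈y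
      roots (suc i) = FieldProperties.x≈y⇒x-y≈0 K (image-fixed (element i))

-- Surjectivity of the norm x ↦ x^(q+1)

module _ {c ℓ} (L : Field c ℓ) m (order : HasOrder L (suc (suc m) ℕ.^ 2)) where
  open Field L hiding (zero)
  open FieldProperties L
  open FiniteField L order
  open MonicPolynomial L
  open IntegerSolver commutativeRing
  open Exp commutativeSemiring using (_^_; ^-congˡ; ^-congʳ; ^-assocʳ)
  open SetoidReasoning setoid

  private
    q : ℕ
    q = suc (suc m)

  module _ {β} (β≉0 : ¬ (β ≈ 0#)) (β^q≈β : β ^ q ≈ β) where
    private
      -- The geometric sum of the β^(k-i) y^i for i from 0 to k, where y = x^(q+1), in a nested form
      -- from which monicity in x can be read off.
      h : ℕ → Carrier → Carrier
      h zero    x = 1#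
      h (suc k) x = β ^ suc k + x ^ suc q * h k x

      h-cong : ∀ k {x y} → x ≈ y → h k x ≈ h k y
      h-cong zero    e = refl
      h-cong (suc k) e = +-congˡ (*-cong (^-congˡ (suc q) e) (h-cong k e))

      h-monic : ∀ k → Monic (k ℕ.* suc q) (h k)
      h-monic zero    = unit (λ _ → refl)
      h-monic (suc k) = a+-monic (β ^ suc k) (x^m*-monic (suc q) (h-monic k))

      geometric : ∀ k x → (x ^ suc q - β) * h k x ≈ (x ^ suc q) ^ suc k - β ^ suc k
      geometric zero    x = solve 2 (λ y β → (y :- β) :* con (+ 1) := y :* con (+ 1) :- β :* con (+ 1)) refl (x ^ suc q) β
      geometric (suc k) x = begin
        (y - β) * (β ^ suc k + y * h k x)
          ≈⟨ solve 4 (λ y β b h → (y :- β) :* (b :+ y :* h) := (y :- β) :* b :+ y :* ((y :- β) :* h)) refl y β (β ^ suc k) (h k x) ⟩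
        (y - β) * β ^ suc k + y * ((y - β) * h k x)
          ≈⟨ +-congˡ (*-congˡ (geometric k x)) ⟩
        (y - β) * β ^ suc k + y * (y ^ suc k - β ^ suc k)
          ≈⟨ solve 4 (λ y β b z → (y :- β) :* b :+ y :* (z :- b) := y :* z :- β :* b) refl y β (β ^ suc k) (y ^ suc k) ⟩
        y * y ^ suc k - β * β ^ suc k ∎
        where y = x ^ suc q

      β^[q-1]≈1 : β ^ suc m ≈ 1#
      β^[q-1]≈1 = *-cancelˡ β≉0 (trans β^q≈β (sym (*-identityʳ β)))

      exponent : ∀ m → suc (suc (suc (suc m)) ℕ.* suc m) ≡ suc (suc m) ℕ.* (suc (suc m) ℕ.* 1)
      exponent = ℕSolver.solve-∀

      norm^[q-1]≈1 : ∀ {x} → ¬ (x ≈ 0#) → (x ^ suc q) ^ suc m ≈ 1#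
      norm^[q-1]≈1 {x} x≉0 = *-cancelˡ x≉0 (begin
        x * (x ^ suc q) ^ suc m       ≈⟨ *-congˡ (^-assocʳ x (suc q) (suc m)) ⟩
        x ^ suc (suc q ℕ.* suc m)     ≈⟨ ^-congʳ x (exponent m) ⟩
        x ^ (q ℕ.^ 2)                 ≈⟨ x^order≈x x ⟩
        x                             ≈⟨ *-identityʳ x ⟨
        x * 1#                        ∎)

      -- The extra factor x accounts for x = 0, whose norm is not a (q-1)-th root of unity. All q²
      -- elements are then roots of a polynomial of degree (q - 2)(q + 1) + 1 = q² - q - 1.
      xh≈0 : (¬ ∃ λ x → x ^ suc q ≈ β) → ∀ x → x * h m x ≈ 0#
      xh≈0 ¬norm x with x ≟ 0#
      ... | yes x≈0 = trans (*-congʳ x≈0) (zeroˡ _)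
      ... | no  x≉0 = trans (*-congˡ (xy≈0⇒y≈0 (x-y≉0 λ eq → ¬norm (x , eq))
        (trans (geometric m x) (x≈y⇒x-y≈0 (trans (norm^[q-1]≈1 x≉0) (sym β^[q-1]≈1)))))) (zeroʳ x)

      slack : ∀ m → suc (suc (m ℕ.* suc (suc (suc m)))) ℕ.+ (m ℕ.+ 2) ≡ suc (suc m) ℕ.* (suc (suc m) ℕ.* 1)
      slack = ℕSolver.solve-∀

      degree< : suc (m ℕ.* suc q) ℕ.< q ℕ.^ 2
      degree< = ≡.subst (suc (suc (m ℕ.* suc q)) ℕ.≤_) (slack m) (ℕ.m≤m+n _ _)

    -- If β were not a norm, then h = (y^(q-1) − β^(q-1))/(y − β) would vanish
    -- at every norm y = x^(q+1) ≠ 0, giving a polynomial in x with too many roots.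
    norm-surjective : ∃ λ x → x ^ suc q ≈ β
    norm-surjective = decidable-stable
      (∃? {P = λ x → x ^ suc q ≈ β} (λ e p → trans (^-congˡ (suc q) (sym e)) p) (λ x → x ^ suc q ≟ β))
      λ ¬norm → let x , xh≉0 = nonroot order (horner 0# (h-monic m) (λ x → sym (+-identityˡ (x * h m x))))
                                 degree< (λ e → *-cong e (h-cong m e))
                in xh≉0 (xh≈0 ¬norm x)

-- Choice of the parameter u

module _ {c ℓ} (F : Field c ℓ) {q} (order : HasOrder F q) (4<q : 4 ℕ.< q) where
  open Field F hiding (zero)
  open FieldProperties F
  open FiniteField F order
  open MonicPolynomial F
  open IntegerSolver commutativeRing
  open SetoidReasoning setoid

  private
    -- This product has degree 5, so counting its roots would settle only q > 5. Splitting by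
    -- characteristic reaches q = 5 and lowers the degree where factors coincide.
    obstruction : Carrier → Carrier
    obstruction u = u * ((u * u - 1#) * (u * u + 1# - u))

    Admissible : Carrier → Set ℓ
    Admissible u = ¬ (u ≈ 0#) × ¬ (u * u ≈ 1#) × ¬ (u * u + 1# - u ≈ 0#)

    admissible : ∀ {u} → ¬ (obstruction u ≈ 0#) → Admissible u
    admissible δ≉0 =
      (λ u≈0 → δ≉0 (trans (*-congʳ u≈0) (zeroˡ _))) ,
      (λ u²≈1 → δ≉0 (trans (*-congˡ (trans (*-congʳ (x≈y⇒x-y≈0 u²≈1)) (zeroˡ _))) (zeroʳ _))) ,
      (λ eq → δ≉0 (trans (*-congˡ (trans (*-congˡ eq) (zeroʳ _))) (zeroʳ _)))

    -- At u = 2 the three factors are 2, 3 and 3.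
    char∤6 : ¬ (1# + 1# ≈ 0#) → ¬ (1# + 1# + 1# ≈ 0#) → Admissible (1# + 1#)
    char∤6 2≉0 3≉0 = admissible λ eq → *-≉0 2≉0 (*-≉0 3≉0 3≉0) (trans
      (solve 0 (let two = con (+ 1) :+ con (+ 1); three = two :+ con (+ 1) in
        two :* (three :* three) := two :* ((two :* two :- con (+ 1)) :* (two :* two :+ con (+ 1) :- two))) refl) eq)

    -- In characteristic 2, u² - 1 = (u - 1)², so it is enough to avoid the roots of the quartic u(u
    -- - 1)(u² - u + 1). Over 𝔽₄ this quartic vanishes everywhere.
    char2 : 1# + 1# ≈ 0# → ∃ Admissible
    char2 2≈0 = let u , fu≉0 = nonroot order f-monic 4<q f-cong in
      u , admissible λ eq → *-≉0 fu≉0 (u-1≉0 fu≉0) (trans (sym (obstruction≈ u)) eq)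
      where
      -- The coefficients 2 and -2 are kept so that the factorisation is an identity over the
      -- integers; 2 = 0 enters only in the comparison with `obstruction`.
      f : Carrier → Carrier
      f u = 0# + u * (- 1# + u * (1# + 1# + u * (- (1# + 1#) + u * 1#)))

      f-monic : Monic 4 f
      f-monic = horner _ (horner _ (horner _ (horner _ (unit {f = λ _ → 1#} (λ _ → refl))
        (λ _ → refl)) (λ _ → refl)) (λ _ → refl)) (λ _ → refl)

      f-cong : ∀ {x y} → x ≈ y → f x ≈ f y
      f-cong e = +-congˡ (*-cong e (+-congˡ (*-cong e (+-congˡ (*-cong e (+-congˡ (*-congʳ e)))))))

      factored : ∀ u → f u ≈ u * (u - 1#) * (u * u + 1# - u)
      factored = solve 1 (λ u → con (+ 0) :+ u :* (:- con (+ 1) :+ u :* (con (+ 1) :+ con (+ 1) :+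
          u :* (:- (con (+ 1) :+ con (+ 1)) :+ u :* con (+ 1)))) :=
        u :* (u :- con (+ 1)) :* (u :* u :+ con (+ 1) :- u)) refl

      u-1≉0 : ∀ {u} → ¬ (f u ≈ 0#) → ¬ (u - 1# ≈ 0#)
      u-1≉0 fu≉0 eq = fu≉0 (trans (factored _)
        (trans (*-congʳ (trans (*-congˡ eq) (zeroʳ _))) (zeroˡ _)))

      obstruction≈ : ∀ u → obstruction u ≈ f u * (u - 1#)
      obstruction≈ u = begin
        obstruction u
          ≈⟨ solve 1 (λ u → u :* ((u :* u :- con (+ 1)) :* (u :* u :+ con (+ 1) :- u)) :=
               u :* (u :- con (+ 1)) :* (u :* u :+ con (+ 1) :- u) :* (u :- con (+ 1)) :+
               (con (+ 1) :+ con (+ 1)) :* (u :* (u :- con (+ 1)) :* (u :* u :+ con (+ 1) :- u))) refl u ⟩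
        u * (u - 1#) * (u * u + 1# - u) * (u - 1#) + (1# + 1#) * (u * (u - 1#) * (u * u + 1# - u))
          ≈⟨ +-cong (*-congʳ (sym (factored u))) (trans (*-congʳ 2≈0) (zeroˡ _)) ⟩
        f u * (u - 1#) + 0#
          ≈⟨ +-identityʳ _ ⟩
        f u * (u - 1#) ∎

    -- In characteristic 3, u² - u + 1 = (u + 1)², so the only values to avoid are the roots 0, 1,
    -- -1 of u³ - u.
    char3 : 1# + 1# + 1# ≈ 0# → ∃ Admissible
    char3 3≈0 = let u , fu≉0 = nonroot order f-monic (ℕ.<-trans ℕ.≤-refl 4<q) f-cong in
      u , admissible λ eq → *-≉0 fu≉0 (*-≉0 (u+1≉0 fu≉0) (u+1≉0 fu≉0)) (trans (sym (obstruction≈ u)) eq)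
      where
      f : Carrier → Carrier
      f u = 0# + u * (- 1# + u * (0# + u * 1#))

      f-monic : Monic 3 f
      f-monic = horner _ (horner _ (horner _ (unit {f = λ _ → 1#} (λ _ → refl))
        (λ _ → refl)) (λ _ → refl)) (λ _ → refl)

      f-cong : ∀ {x y} → x ≈ y → f x ≈ f y
      f-cong e = +-congˡ (*-cong e (+-congˡ (*-cong e (+-congˡ (*-congʳ e)))))

      factored : ∀ u → f u ≈ u * (u - 1#) * (u + 1#)
      factored = solve 1 (λ u → con (+ 0) :+ u :* (:- con (+ 1) :+ u :* (con (+ 0) :+ u :* con (+ 1))) :=
        u :* (u :- con (+ 1)) :* (u :+ con (+ 1))) refl

      u+1≉0 : ∀ {u} → ¬ (f u ≈ 0#) → ¬ (u + 1# ≈ 0#)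
      u+1≉0 fu≉0 eq = fu≉0 (trans (factored _) (trans (*-congˡ eq) (zeroʳ _)))

      obstruction≈ : ∀ u → obstruction u ≈ f u * ((u + 1#) * (u + 1#))
      obstruction≈ u = begin
        obstruction u
          ≈⟨ solve 1 (λ u → u :* ((u :* u :- con (+ 1)) :* (u :* u :+ con (+ 1) :- u)) :=
               u :* (u :- con (+ 1)) :* (u :+ con (+ 1)) :* ((u :+ con (+ 1)) :* (u :+ con (+ 1))) :-
               (con (+ 1) :+ con (+ 1) :+ con (+ 1)) :* (u :* u :* (u :* u :- con (+ 1)))) refl u ⟩
        u * (u - 1#) * (u + 1#) * ((u + 1#) * (u + 1#)) - (1# + 1# + 1#) * (u * u * (u * u - 1#))
          ≈⟨ +-cong (*-congʳ (sym (factored u))) (-‿cong (trans (*-congʳ 3≈0) (zeroˡ _))) ⟩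
        f u * ((u + 1#) * (u + 1#)) - 0#
          ≈⟨ solve 1 (λ x → x :- con (+ 0) := x) refl _ ⟩
        f u * ((u + 1#) * (u + 1#)) ∎

  admissible-parameter : ∃ λ u → ¬ (u ≈ 0#) × ¬ (u * u ≈ 1#) × ¬ (u * u + 1# - u ≈ 0#)
  admissible-parameter with 1# + 1# ≟ 0# | 1# + 1# + 1# ≟ 0#
  ... | yes 2≈0 | _       = char2 2≈0
  ... | no  _   | yes 3≈0 = char3 3≈0
  ... | no  2≉0 | no  3≉0 = 1# + 1# , char∤6 2≉0 3≉0

-- Vectors over a finite field, cardinality and dimension

funToFin-cong : ∀ {m n} {f g : Fin m → Fin n} → (∀ i → f i ≡ g i) → funToFin f ≡ funToFin g
funToFin-cong {zero}  f≗g = ≡.refl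
funToFin-cong {suc m} f≗g = ≡.cong₂ Fin.combine (f≗g zero) (funToFin-cong (λ i → f≗g (suc i)))

module FiniteVectors {c ℓ} (F : Field c ℓ) {q} (order : HasOrder F q) where
  open Field F hiding (zero)
  open FiniteField F order

  vector : ∀ n → Fin (q ℕ.^ n) → Vector Carrier n
  vector n k i = element (finToFun k i)

  vectorIndex : ∀ {n} → Vector Carrier n → Fin (q ℕ.^ n)
  vectorIndex a = funToFin (index ∘ a)

  vector-vectorIndex : ∀ {n} (a : Vector Carrier n) i → vector n (vectorIndex a) i ≈ a i
  vector-vectorIndex a i = trans (reflexive (≡.cong element (Fin.finToFun-funToFin (index ∘ a) i)))
    (element-index (a i))

  vector-injective : ∀ {n k l} → (∀ i → vector n k i ≈ vector n l i) → k ≡ l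
  vector-injective {n} {k} {l} eq = ≡.trans (≡.sym (Fin.funToFin-finToFin {n} k))
    (≡.trans (funToFin-cong {n} (λ i → element-injective (eq i))) (Fin.funToFin-finToFin {n} l))

  -- Representatives of projective points whose leading 1 is in the first or second place; a scalar
  -- relating two of them must be 1. These two families are numerous enough for the pigeonhole
  -- argument below.
  normalised : ∀ m → Fin (q ℕ.^ suc m) ⊎ Fin (q ℕ.^ m) → Vector Carrier (suc (suc m))
  normalised m (inj₁ k) = 1# ∷ vector (suc m) k
  normalised m (inj₂ k) = 0# ∷ 1# ∷ vector m k

  normalised-≉0 : ∀ m k → ¬ (∀ i → normalised m k i ≈ 0#)
  normalised-≉0 m (inj₁ _) ≈0 = 1≉0 (≈0 zero)
  normalised-≉0 m (inj₂ _) ≈0 = 1≉0 (≈0 (suc zero))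

  private
    1≈c*1⇒c*x≈x : ∀ {c} → 1# ≈ c * 1# → ∀ x → c * x ≈ x
    1≈c*1⇒c*x≈x eq x = trans (*-congʳ (sym (trans eq (*-identityʳ _)))) (*-identityˡ x)

  normalised-proportional : ∀ m k l a → (∀ i → normalised m k i ≈ a * normalised m l i) → k ≡ l
  normalised-proportional m (inj₁ k) (inj₁ l) a eq = ≡.cong inj₁ (vector-injective λ i →
    trans (eq (suc i)) (1≈c*1⇒c*x≈x (eq zero) _))
  normalised-proportional m (inj₁ k) (inj₂ l) a eq = contradiction (trans (eq zero) (zeroʳ a)) 1≉0
  normalised-proportional m (inj₂ k) (inj₁ l) a eq = contradiction
    (trans (eq (suc zero)) (trans (*-congʳ (trans (sym (*-identityʳ a)) (sym (eq zero)))) (zeroˡ _))) 1≉0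
  normalised-proportional m (inj₂ k) (inj₂ l) a eq = ≡.cong inj₂ (vector-injective λ i →
    trans (eq (suc (suc i))) (1≈c*1⇒c*x≈x (eq (suc zero)) _))

module FiniteDimension {c ℓ m ℓm} (F : Field c ℓ) {q} (order : HasOrder F q)
                       (M : LeftModule (Field.ring F) m ℓm) where
  open Field F hiding (zero)
  open FieldProperties F
  open FiniteField F order
  open FiniteVectors F order
  open LeftModule M
  open LinearAlgebra M
  open MonoidSum +ᴹ-commutativeMonoid using (sum-cong-≋; ∑-distrib-+)
  open GroupProperties +ᴹ-group using () renaming (inverseˡ-unique to +ᴹ-inverseˡ-unique)

  private
    variable
      n : ℕ

  linearCombination-cong : ∀ {a b} (v : Vector Carrierᴹ n) → (∀ i → a i ≈ b i) →
                           linearCombination a v ≈ᴹ linearCombination b v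
  linearCombination-cong v a≈b = sum-cong-≋ (λ i → *ₗ-congʳ (a≈b i))

  linearCombination-+ : ∀ a b (v : Vector Carrierᴹ n) →
    linearCombination (λ i → a i + b i) v ≈ᴹ linearCombination a v +ᴹ linearCombination b v
  linearCombination-+ {n} a b v = ≈ᴹ-trans (sum-cong-≋ (λ i → *ₗ-distribʳ (v i) (a i) (b i)))
    (∑-distrib-+ {n} (λ i → a i *ₗ v i) (λ i → b i *ₗ v i))

  linearCombination-* : ∀ x a (v : Vector Carrierᴹ n) →
    linearCombination (λ i → x * a i) v ≈ᴹ x *ₗ linearCombination a v
  linearCombination-* {zero}  x a v = ≈ᴹ-sym (*ₗ-zeroʳ x)
  linearCombination-* {suc n} x a v = ≈ᴹ-trans
    (+ᴹ-cong (*ₗ-assoc x (head a) (head v)) (linearCombination-* x (tail a) (tail v)))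
    (≈ᴹ-sym (*ₗ-distribˡ x _ _))

  -1*ₗ : ∀ u → (- 1#) *ₗ u ≈ᴹ -ᴹ u
  -1*ₗ u = +ᴹ-inverseˡ-unique _ _ (begin
    (- 1#) *ₗ u +ᴹ u          ≈⟨ +ᴹ-congˡ (*ₗ-identityˡ u) ⟨
    (- 1#) *ₗ u +ᴹ 1# *ₗ u    ≈⟨ *ₗ-distribʳ u (- 1#) 1# ⟨
    (- 1# + 1#) *ₗ u          ≈⟨ *ₗ-congʳ (-‿inverseˡ 1#) ⟩
    0# *ₗ u                   ≈⟨ *ₗ-zeroˡ u ⟩
    0ᴹ                        ∎)
    where open SetoidReasoning ≈ᴹ-setoid

  independent-injective : ∀ {v : Vector Carrierᴹ n} → LinearlyIndependent v → ∀ a b →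
    linearCombination a v ≈ᴹ linearCombination b v → ∀ i → a i ≈ b i
  independent-injective {v = v} independent a b eq i = x-y≈0⇒x≈y _ _ (trans
    (+-congˡ (trans (-‿cong (sym (*-identityˡ (b i)))) (-‿distribˡ-* 1# (b i))))
    (independent (λ i → a i + - 1# * b i) (begin
      linearCombination (λ i → a i + - 1# * b i) v
        ≈⟨ linearCombination-+ a _ v ⟩
      linearCombination a v +ᴹ linearCombination (λ i → - 1# * b i) v
        ≈⟨ +ᴹ-cong eq (≈ᴹ-trans (linearCombination-* (- 1#) b v) (-1*ₗ _)) ⟩
      linearCombination b v +ᴹ -ᴹ linearCombination b v
        ≈⟨ -ᴹ‿inverseʳ _ ⟩
      0ᴹ ∎) i))
    where
    open SetoidReasoning ≈ᴹ-setoid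
    open RingProperties ring using (-‿distribˡ-*)

  independent-extend : ∀ {v : Vector Carrierᴹ n} {u} → LinearlyIndependent v →
    ¬ (∃ λ a → u ≈ᴹ linearCombination a v) → LinearlyIndependent (u ∷ v)
  independent-extend {v = v} {u} independent ∉span a lc≈0 with a zero ≟ 0#
  ... | yes a₀≈0 = λ where
    zero    → a₀≈0
    (suc i) → independent (tail a) (≈ᴹ-trans (≈ᴹ-sym (≈ᴹ-trans
      (+ᴹ-congʳ (≈ᴹ-trans (*ₗ-congʳ a₀≈0) (*ₗ-zeroˡ u))) (+ᴹ-identityˡ _))) lc≈0) i
  ... | no  a₀≉0 with b , a₀b≈1 ← inverses (a zero) a₀≉0 = contradiction
    ((λ i → b * (- 1# * a (suc i))) , (begin
      u                                  ≈⟨ *ₗ-identityˡ u ⟨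
      1# *ₗ u                            ≈⟨ *ₗ-congʳ (trans (*-comm b _) a₀b≈1) ⟨
      (b * a zero) *ₗ u                  ≈⟨ *ₗ-assoc b (a zero) u ⟩
      b *ₗ (a zero *ₗ u)                 ≈⟨ *ₗ-congˡ (+ᴹ-inverseˡ-unique _ _ lc≈0) ⟩
      b *ₗ -ᴹ linearCombination (tail a) v
        ≈⟨ *ₗ-congˡ (-1*ₗ _) ⟨
      b *ₗ ((- 1#) *ₗ linearCombination (tail a) v)
        ≈⟨ *ₗ-congˡ (linearCombination-* (- 1#) (tail a) v) ⟨
      b *ₗ linearCombination (λ i → - 1# * a (suc i)) v
        ≈⟨ linearCombination-* b _ v ⟨
      linearCombination (λ i → b * (- 1# * a (suc i))) v ∎)) ∉span
    where open SetoidReasoning ≈ᴹ-setoid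

  linearCombination-closed : ∀ {p} {U : Pred Carrierᴹ p} → IsSubspace U → ∀ a {v : Vector Carrierᴹ n} →
    (∀ i → U (v i)) → U (linearCombination a v)
  linearCombination-closed {zero}  U-sub a v∈U = IsSubspace.0-closed U-sub
  linearCombination-closed {suc n} U-sub a v∈U = IsSubspace.+-closed U-sub
    (IsSubspace.*ₗ-closed U-sub _ (v∈U zero)) (linearCombination-closed U-sub (tail a) (λ i → v∈U (suc i)))

  -- The code is defined on the whole module but separates only the members of U. Members are thus
  -- compared, decidably, without carrying membership proofs along.
  record HasSize {p} (U : Pred Carrierᴹ p) (N : ℕ) : Set (m ⊔ ℓm ⊔ p) where
    field
      member         : Fin N → Carrierᴹ
      member∈        : ∀ i → U (member i)
      code           : Carrierᴹ → Fin N
      code-cong      : ∀ {u v} → u ≈ᴹ v → code u ≡ code v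
      code-injective : ∀ {u v} → U u → U v → code u ≡ code v → u ≈ᴹ v
      code-member    : ∀ i → code (member i) ≡ i

  module _ {p} {U : Pred Carrierᴹ p} {N} (size : HasSize U N) (subspace : IsSubspace U) where
    open HasSize size

    independent⇒≤ : ∀ {v : Vector Carrierᴹ n} → (∀ i → U (v i)) → LinearlyIndependent v → q ℕ.^ n ℕ.≤ N
    independent⇒≤ {v = v} v∈U independent =
      Fin.injective⇒≤ {f = λ k → code (linearCombination (vector _ k) v)} λ eq →
        vector-injective (independent-injective independent _ _
          (code-injective (closed _) (closed _) eq))
      where closed = λ a → linearCombination-closed subspace a v∈U

    spanning⇒≥ : ∀ {v : Vector Carrierᴹ n} →
      (∀ {u} → U u → ∃ λ a → u ≈ᴹ linearCombination a v) → N ℕ.≤ q ℕ.^ n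
    spanning⇒≥ {v = v} spanning =
      Fin.injective⇒≤ {f = λ i → vectorIndex (proj₁ (spanning (member∈ i)))} λ {i} {j} eq → begin
        i                  ≡⟨ code-member i ⟨
        code (member i)    ≡⟨ code-cong (≈ᴹ-trans (expand i) (≈ᴹ-trans
                                (≈ᴹ-reflexive (≡.cong (λ k → linearCombination (vector _ k) v) eq))
                                (≈ᴹ-sym (expand j)))) ⟩
        code (member j)    ≡⟨ code-member j ⟩
        j                  ∎
      where
      open ≡.≡-Reasoning
      expand : ∀ i → member i ≈ᴹ linearCombination (vector _ (vectorIndex (proj₁ (spanning (member∈ i))))) v
      expand i = ≈ᴹ-trans (proj₂ (spanning (member∈ i)))
        (linearCombination-cong v (λ j → sym (vector-vectorIndex _ j)))

    in-span? : ∀ {v : Vector Carrierᴹ n} → (∀ i → U (v i)) →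
      ∀ i → Dec (∃ λ k → member i ≈ᴹ linearCombination (vector n k) v)
    in-span? v∈U i = Fin.any? λ k → map′
      (code-injective (member∈ i) (linearCombination-closed subspace _ v∈U)) code-cong
      (code (member i) Fin.≟ code _)

    basis-or-extension : ∀ {v : Vector Carrierᴹ n} → (∀ i → U (v i)) → LinearlyIndependent v →
      HasDimension U n ⊎ (∃ λ (w : Vector Carrierᴹ (suc n)) → (∀ i → U (w i)) × LinearlyIndependent w)
    basis-or-extension {n} {v} v∈U independent with Fin.all? (in-span? v∈U)
    ... | yes spans = inj₁ (v , record
      { contained   = v∈U
      ; independent = independent
      ; spanning    = λ {u} u∈U → let k , eq = spans (code u) in vector n k , ≈ᴹ-trans
          (code-injective u∈U (member∈ _) (≡.sym (code-member (code u)))) eq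
      })
    ... | no ¬spans = let i , i∉ = Fin.¬∀⟶∃¬ N _ (in-span? v∈U) ¬spans in inj₂
      ( member i ∷ v
      , (λ { zero → member∈ i ; (suc j) → v∈U j })
      , independent-extend independent λ (a , eq) → i∉ (vectorIndex a , ≈ᴹ-trans eq
          (linearCombination-cong v (λ j → sym (vector-vectorIndex a j))))
      )

    -- Greedy construction of a basis: an independent family in U either spans U or misses a member,
    -- found by finite search, that can be adjoined.
    grow : ∀ n → (∃ λ k → HasDimension U k) ⊎
      (∃ λ (w : Vector Carrierᴹ n) → (∀ i → U (w i)) × LinearlyIndependent w)
    grow zero = inj₂ ([] , (λ ()) , (λ _ _ ()))
    grow (suc n) with grow n
    ... | inj₁ dim = inj₁ dim
    ... | inj₂ (w , w∈U , independent) with basis-or-extension w∈U independent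
    ...   | inj₁ dim = inj₁ (n , dim)
    ...   | inj₂ larger = inj₂ larger

  size⇒dimension : 1 ℕ.< q → ∀ {p} {U : Pred Carrierᴹ p} → HasSize U (q ℕ.^ n) → IsSubspace U → HasDimension U n
  -- Asking for n + 1 independent vectors forces the process to stop with a basis, since they would
  -- give q^(n+1) distinct members.
  size⇒dimension {n} 1<q {U = U} size subspace with grow size subspace (suc n)
  ... | inj₂ (w , w∈U , independent) = contradiction
    (independent⇒≤ size subspace w∈U independent) (ℕ.<⇒≱ (ℕ.^-monoʳ-< q 1<q (ℕ.n<1+n n)))
  ... | inj₁ (k , v , basis) = ≡.subst (HasDimension U) (ℕ.≤-antisym k≤n n≤k) (v , basis)
    where
    k≤n : k ℕ.≤ n
    k≤n = ℕ.≮⇒≥ λ n<k → ℕ.<⇒≱ (ℕ.^-monoʳ-< q 1<q n<k)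
      (independent⇒≤ size subspace (IsBasis.contained basis) (IsBasis.independent basis))
    n≤k : n ℕ.≤ k
    n≤k = ℕ.≮⇒≥ λ k<n → ℕ.<⇒≱ (ℕ.^-monoʳ-< q 1<q k<n) (spanning⇒≥ size subspace {v = v} (IsBasis.spanning basis))

-- Upper bound on the dimension of scattered subspaces

module ScatteredBound {c ℓ} (F K : Field c ℓ) (ι : Embedding F K) {q n}
                      (F-order : HasOrder F q) (K-order : HasOrder K n) where
  open Scattered F K ι
  private
    module F = Field F
    module V = LinearAlgebra planeOverF
    module M = LeftModule planeOverF
  open Field K hiding (zero)
  open FieldProperties K
  open FiniteField K K-order
  open FiniteVectors F F-order using (normalised; normalised-≉0; normalised-proportional)
  open FiniteDimension F F-order planeOverF
  open LeftModule plane using (Carrierᴹ; _≈ᴹ_; 0ᴹ; ≈ᴹ-sym; ≈ᴹ-trans; +ᴹ-identityʳ)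
  open LinearAlgebra plane using (⟨_⟩)

  -- The points of the projective line over K: the slope z / y, or ∞ if y = 0.
  point : Carrierᴹ → Fin (suc n)
  point (y , z) with y ≟ 0#
  ... | yes _   = zero
  ... | no  y≉0 = suc (index (proj₁ (divide z y≉0)))

  same-point⇒collinear : ∀ {u v} → ¬ (u ≈ᴹ 0ᴹ) → point u ≡ point v → ⟨ u ⟩ v
  same-point⇒collinear {y , z} {y′ , z′} u≉0 eq with y ≟ 0# | y′ ≟ 0#
  ... | yes y≈0 | yes y′≈0 with a , az≈z′ ← divide z′ {z} (λ z≈0 → u≉0 (y≈0 , z≈0)) =
    a , trans y′≈0 (sym (trans (*-congˡ y≈0) (zeroʳ a))) , sym az≈z′
  ... | no y≉0 | no y′≉0 = a , sym ay≈y′ , (begin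
    z′                   ≈⟨ proj₂ (divide z′ y′≉0) ⟨
    s′ * y′              ≈⟨ *-cong (sym (index-injective (Fin.suc-injective eq))) (sym ay≈y′) ⟩
    s * (a * y)          ≈⟨ *-congˡ (*-comm a y) ⟩
    s * (y * a)          ≈⟨ *-assoc s y a ⟨
    s * y * a            ≈⟨ *-comm _ a ⟩
    a * (s * y)          ≈⟨ *-congˡ (proj₂ (divide z y≉0)) ⟩
    a * z                ∎)
    where
    open SetoidReasoning setoid
    s     = proj₁ (divide z y≉0)
    s′    = proj₁ (divide z′ y′≉0)
    a     = proj₁ (divide y′ y≉0)
    ay≈y′ = proj₂ (divide y′ y≉0)
  same-point⇒collinear u≉0 () | yes _ | no _
  same-point⇒collinear u≉0 () | no _ | yes _

  module _ {p} {W : Pred Carrierᴹ p} (scattered : IsScattered W) where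

    -- The K-line of u meets W in dimension at most 1, and exactly 1 because it contains u ≠ 0. Both
    -- vectors are then F-multiples of a single basis vector.
    collinear⇒proportional : ∀ {u v} → ¬ (u ≈ᴹ 0ᴹ) → W u → W v → ⟨ u ⟩ v → ∃ λ a → v ≈ᴹ a M.*ₗ u
    collinear⇒proportional {u} {v} u≉0 u∈W v∈W v∈⟨u⟩ with scattered u u≉0
    ... | 0 , _ , w , basis = contradiction
      (proj₂ (V.IsBasis.spanning basis ((1# , ≈ᴹ-sym (LeftModule.*ₗ-identityˡ plane u)) , u∈W))) u≉0
    ... | 1 , _ , w , basis
      with a , u≈ ← V.IsBasis.spanning basis ((1# , ≈ᴹ-sym (LeftModule.*ₗ-identityˡ plane u)) , u∈W)
         | b , v≈ ← V.IsBasis.spanning basis (v∈⟨u⟩ , v∈W)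
      with d , da≈b ← FieldProperties.divide F (b zero) {a zero} (λ a≈0 → u≉0 (≈ᴹ-trans u≈
             (≈ᴹ-trans (+ᴹ-identityʳ _) (≈ᴹ-trans (M.*ₗ-congʳ a≈0) (M.*ₗ-zeroˡ (w zero))))))
      = d , (begin
        v                                ≈⟨ ≈ᴹ-trans v≈ (+ᴹ-identityʳ _) ⟩
        b zero M.*ₗ w zero               ≈⟨ M.*ₗ-congʳ da≈b ⟨
        (d F.* a zero) M.*ₗ w zero       ≈⟨ M.*ₗ-assoc d (a zero) (w zero) ⟩
        d M.*ₗ (a zero M.*ₗ w zero)      ≈⟨ M.*ₗ-congˡ (≈ᴹ-trans u≈ (+ᴹ-identityʳ _)) ⟨
        d M.*ₗ u                         ∎)
      where open SetoidReasoning M.≈ᴹ-setoid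
    ... | suc (suc _) , ℕ.s≤s () , _

    scattered-dimension : V.IsSubspace W → ∀ k → n ≡ q ℕ.^ k → 1 ℕ.< k → 1 ℕ.< q → ∀ e → V.HasDimension W e → e ℕ.≤ k
    scattered-dimension subspace k n≡q^k 1<k 1<q e (v , basis) = ℕ.≮⇒≥ λ k<e → too-large e k<e v basis
      where
      too-large : ∀ e → k ℕ.< e → (v : Vector Carrierᴹ e) → ¬ V.IsBasis W v
      too-large zero ()
      too-large (suc zero) k<1 = contradiction (ℕ.<-trans 1<k k<1) ℕ.1+n≰n
      too-large (suc (suc m)) (ℕ.s≤s k≤1+m) v basis = collision (Fin.pigeonhole points< (λ i → point (vec i)))
        where
        open V.IsBasis basis
        coefficients : Fin (q ℕ.^ suc m ℕ.+ q ℕ.^ m) → Vector F.Carrier (suc (suc m))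
        coefficients i = normalised m (Fin.splitAt (q ℕ.^ suc m) i)

        vec : Fin (q ℕ.^ suc m ℕ.+ q ℕ.^ m) → Carrierᴹ
        vec i = V.linearCombination (coefficients i) v

        vec∈W : ∀ i → W (vec i)
        vec∈W i = linearCombination-closed subspace (coefficients i) contained

        vec≉0 : ∀ i → ¬ (vec i ≈ᴹ 0ᴹ)
        vec≉0 i eq = normalised-≉0 m (Fin.splitAt (q ℕ.^ suc m) i) (independent (coefficients i) eq)

        -- Here n = q^k is at most q^(m+1), and 1 < k ≤ m + 1 gives m ≥ 1, so that the second
        -- summand is at least q and exceeds 1.
        points< : suc n ℕ.< q ℕ.^ suc m ℕ.+ q ℕ.^ m
        points< = ≡.subst (ℕ._< q ℕ.^ suc m ℕ.+ q ℕ.^ m) (ℕ.+-comm n 1)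
          (ℕ.+-mono-≤-< (≡.subst (ℕ._≤ q ℕ.^ suc m) (≡.sym n≡q^k) (^-monoʳ k≤1+m))
            (ℕ.<-≤-trans 1<q (≡.subst (ℕ._≤ q ℕ.^ m) (ℕ.*-identityʳ q) (^-monoʳ (ℕ.s≤s⁻¹ (ℕ.≤-trans 1<k k≤1+m))))))
          where
          ^-monoʳ : ∀ {i j} → i ℕ.≤ j → q ℕ.^ i ℕ.≤ q ℕ.^ j
          ^-monoʳ = ℕ.^-monoʳ-≤ q {{ℕ.>-nonZero (ℕ.<-trans ℕ.z<s 1<q)}}

        collision : ¬ (∃₂ λ i j → i Fin.< j × point (vec i) ≡ point (vec j))
        collision (i , j , i<j , eq)
          with a , v≈au ← collinear⇒proportional (vec≉0 i) (vec∈W i) (vec∈W j) (same-point⇒collinear (vec≉0 i) eq) =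
          Fin.<⇒≢ i<j (≡.sym (splitAt-injective (normalised-proportional m _ _ a
            (independent-injective {v = v} independent _ _
              (≈ᴹ-trans v≈au (≈ᴹ-sym (linearCombination-* a (coefficients i) v)))))))
          where
          splitAt-injective : ∀ {i j} → Fin.splitAt (q ℕ.^ suc m) i ≡ Fin.splitAt (q ℕ.^ suc m) j → i ≡ j
          splitAt-injective {i} {j} eq = ≡.trans (≡.sym (Fin.join-splitAt (q ℕ.^ suc m) _ i))
            (≡.trans (≡.cong (Fin.join _ _) eq) (Fin.join-splitAt (q ℕ.^ suc m) _ j))

-- The subspace as the graph of a q-polynomial

module Family {c ℓ} {q} (q-primePower : IsPrimePower q) (1<q : 1 ℕ.< q)
              (F K : Field c ℓ) (F-order : HasOrder F q) (K-order : HasOrder K (q ℕ.^ 6))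
              (ι : Embedding F K) where
  open Scattered F K ι
  private
    module F = Field F
    module Eι = FieldEmbedding F K ι
    module V = LinearAlgebra planeOverF
  open Field K hiding (zero)
  open FieldProperties K
  open FiniteField K K-order
  open IntegerSolver commutativeRing
  open FiniteDimension F F-order planeOverF using (HasSize; size⇒dimension)
  open Exp commutativeSemiring using (^-congˡ; ^-congʳ; ^-assocʳ) renaming (_^_ to _^ₖ_)
  open LeftModule plane using (Carrierᴹ)
  open RingHomomorphism ι using () renaming (⟦_⟧ to ι⟦_⟧; 0#-homo to ι-0#)

  instance
    q≢0 : ℕ.NonZero q
    q≢0 = ℕ.>-nonZero (ℕ.<-trans ℕ.z<s 1<q)

  frobenius : RingHomomorphism rawRing rawRing
  frobenius = power-endomorphism K q (frobenius-additive K 6 q-primePower K-order)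

  open RingHomomorphism frobenius using () renaming
    (⟦_⟧ to σ; ⟦⟧-cong to σ-cong; +-homo to σ-+; *-homo to σ-*)

  -- Iterates, unlike the powers x^(q^k), unfold to the nested applications of σ in which the
  -- cross-ratio argument is phrased.
  σ^ : ℕ → Carrier → Carrier
  σ^ zero    x = x
  σ^ (suc k) x = σ (σ^ k x)

  σ^≈^ : ∀ k x → σ^ k x ≈ x ^ₖ (q ℕ.^ k)
  σ^≈^ zero    x = sym (*-identityʳ x)
  σ^≈^ (suc k) x = begin
    σ^ k x ^ₖ q                ≈⟨ ^-congˡ q (σ^≈^ k x) ⟩
    (x ^ₖ (q ℕ.^ k)) ^ₖ q      ≈⟨ ^-assocʳ x (q ℕ.^ k) q ⟩
    x ^ₖ (q ℕ.^ k ℕ.* q)       ≈⟨ ^-congʳ x (ℕ.*-comm (q ℕ.^ k) q) ⟩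
    x ^ₖ (q ℕ.* q ℕ.^ k)       ∎
    where open SetoidReasoning setoid

  σ^-cong : ∀ k {x y} → x ≈ y → σ^ k x ≈ σ^ k y
  σ^-cong zero    e = e
  σ^-cong (suc k) e = σ-cong (σ^-cong k e)

  σ^-+ : ∀ k x y → σ^ k (x + y) ≈ σ^ k x + σ^ k y
  σ^-+ zero    x y = refl
  σ^-+ (suc k) x y = trans (σ-cong (σ^-+ k x y)) (σ-+ _ _)

  σ^-* : ∀ k x y → σ^ k (x * y) ≈ σ^ k x * σ^ k y
  σ^-* zero    x y = refl
  σ^-* (suc k) x y = trans (σ-cong (σ^-* k x y)) (σ-* _ _)

  σ^-fixed : ∀ k {x} → σ x ≈ x → σ^ k x ≈ x
  σ^-fixed zero    e = refl
  σ^-fixed (suc k) e = trans (σ-cong (σ^-fixed k e)) e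

  σ-ι : ∀ a → σ ι⟦ a ⟧ ≈ ι⟦ a ⟧
  σ-ι = Eι.image-fixed F-order

  σ⁶ : ∀ x → σ^ 6 x ≈ x
  σ⁶ x = trans (σ^≈^ 6 x) (x^order≈x x)

  module _ (b : Carrier) where

    f : Carrier → Carrier
    f x = b * σ^ 1 x + σ^ 4 x

    f≈ : ∀ x → f x ≈ b * x ^ₖ q + x ^ₖ (q ℕ.^ 4)
    f≈ x = +-congˡ (σ^≈^ 4 x)

    f-cong : ∀ {x y} → x ≈ y → f x ≈ f y
    f-cong e = +-cong (*-congˡ (σ^-cong 1 e)) (σ^-cong 4 e)

    f-+ : ∀ x y → f (x + y) ≈ f x + f y
    f-+ x y = trans (+-cong (*-congˡ (σ^-+ 1 x y)) (σ^-+ 4 x y))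
      (solve 5 (λ b u v w z → b :* (u :+ v) :+ (w :+ z) := (b :* u :+ w) :+ (b :* v :+ z)) refl b _ _ _ _)

    f-ι* : ∀ a x → f (ι⟦ a ⟧ * x) ≈ ι⟦ a ⟧ * f x
    f-ι* a x = trans
      (+-cong (*-congˡ (trans (σ^-* 1 _ x) (*-congʳ (σ-ι a))))
              (trans (σ^-* 4 _ x) (*-congʳ (σ^-fixed 4 (σ-ι a)))))
      (solve 4 (λ b a u v → b :* (a :* u) :+ a :* v := a :* (b :* u :+ v)) refl b ι⟦ a ⟧ _ _)

    U : Pred Carrierᴹ _
    U = U⟨_,1⟩ K b q

    graph : ∀ {y z} → z ≈ f y → U (y , z)
    graph z≈fy = _ , refl , trans z≈fy (f≈ _)

    graph⁻¹ : ∀ {y z} → U (y , z) → z ≈ f y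
    graph⁻¹ (x , y≈x , z≈fx) = trans z≈fx (trans (sym (f≈ x)) (f-cong (sym y≈x)))

    U-subspace : V.IsSubspace U
    U-subspace = record
      { respects  = λ (y≈y′ , z≈z′) u∈U → graph (trans (sym z≈z′) (trans (graph⁻¹ u∈U) (f-cong y≈y′)))
      -- That f vanishes at 0 is homogeneity with the scalar 0.
      ; 0-closed  = graph (sym (trans (f-cong (sym ι0*0)) (trans (f-ι* F.0# 0#) (trans (*-congʳ ι-0#) (zeroˡ _)))))
      ; +-closed  = λ u∈U v∈U → graph (trans (+-cong (graph⁻¹ u∈U) (graph⁻¹ v∈U)) (sym (f-+ _ _)))
      ; *ₗ-closed = λ a u∈U → graph (trans (*-congˡ (graph⁻¹ u∈U)) (sym (f-ι* a _)))
      }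
      where
      ι0*0 : ι⟦ F.0# ⟧ * 0# ≈ 0#
      ι0*0 = zeroʳ _

    U-size : HasSize U (q ℕ.^ 6)
    U-size = record
      { member         = λ i → element i , f (element i)
      ; member∈        = λ i → graph refl
      ; code           = λ (y , z) → index y
      ; code-cong      = λ (y≈y′ , _) → index-cong y≈y′
      ; code-injective = λ u∈U v∈U eq → index-injective eq ,
          trans (graph⁻¹ u∈U) (trans (f-cong (index-injective eq)) (sym (graph⁻¹ v∈U)))
      ; code-member    = index-element
      }

    module _ (collinear⇒proportional : ∀ {x y} → ¬ (x ≈ 0#) → x * f y ≈ y * f x → ∃ λ a → y ≈ ι⟦ a ⟧ * x) where

      U-scattered : IsScattered U
      -- An explicit dimension is required, so a finite search decides whether some nonzero (x, f x)
      -- lies on the line. If so, that vector alone is a basis of the intersection.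
      U-scattered v v≉0 with ∃? on-line-cong (λ x → ¬? (x ≟ 0#) ×-dec
          ∃? (λ e (p , p′) → trans p (*-congʳ e) , trans p′ (*-congʳ e))
             (λ a → (x ≟ a * proj₁ v) ×-dec (f x ≟ a * proj₂ v)))
        where
        on-line-cong : ∀ {x y} → x ≈ y →
          ¬ (x ≈ 0#) × ∃ (λ a → x ≈ a * proj₁ v × f x ≈ a * proj₂ v) →
          ¬ (y ≈ 0#) × ∃ (λ a → y ≈ a * proj₁ v × f y ≈ a * proj₂ v)
        on-line-cong e (x≉0 , a , p , p′) = (λ y≈0 → x≉0 (trans e y≈0)) , a ,
          trans (sym e) p , trans (f-cong (sym e)) p′
      ... | no empty = 0 , ℕ.z≤n , [] , record
        { contained   = λ ()
        ; independent = λ _ _ ()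
        ; spanning    = λ {(y , z)} ((a , y≈ , z≈) , u∈U) →
            let y≈0 = decidable-stable (y ≟ 0#) λ y≉0 → empty (y , y≉0 , a , y≈ , trans (sym (graph⁻¹ u∈U)) z≈)
            in (λ ()) , y≈0 , trans (graph⁻¹ u∈U) (trans (f-cong y≈0)
                 (sym (graph⁻¹ (V.IsSubspace.0-closed U-subspace))))
        }
      ... | yes (x , x≉0 , a , x≈ , fx≈) = 1 , ℕ.s≤s ℕ.z≤n , (λ _ → x , f x) , record
        { contained   = λ _ → (a , x≈ , fx≈) , graph refl
        ; independent = λ where
            k (kx≈0 , _) zero → decidable-stable (FiniteField._≟_ F F-order (k zero) F.0#) λ k≉0 →
              *-≉0 (Eι.embedding-≉0 F-order k≉0) x≉0 (trans (sym (+-identityʳ _)) kx≈0)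
        ; spanning    = λ {(y , z)} ((a′ , y≈ , z≈) , u∈U) →
            let k , y≈kx = collinear⇒proportional x≉0 (proportional {a = a} {a′} x≈ fx≈ y≈ (trans (sym (graph⁻¹ u∈U)) z≈))
            in (λ _ → k) , trans y≈kx (sym (+-identityʳ _)) ,
               trans (graph⁻¹ u∈U) (trans (f-cong y≈kx) (trans (f-ι* k x) (sym (+-identityʳ _))))
        }
        where
        proportional : ∀ {x x′ y y′ a a′ v v′} → x ≈ a * v → x′ ≈ a * v′ → y ≈ a′ * v → y′ ≈ a′ * v′ → x * y′ ≈ y * x′
        proportional {a = a} {a′} {v} {v′} p p′ r r′ = trans (*-cong p r′) (trans
          (solve 4 (λ a b v w → a :* v :* (b :* w) := b :* v :* (a :* w)) refl a a′ v v′)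
          (sym (*-cong r p′)))

      U-maximumScattered : IsMaximumScattered U
      U-maximumScattered = record
        { isSubspace   = U-subspace
        ; isScattered  = U-scattered
        ; dimension    = 6
        ; hasDimension = size⇒dimension 1<q U-size U-subspace
        ; maximum      = λ W subspace scattered → ScatteredBound.scattered-dimension F K ι F-order K-order
            scattered subspace 6 ≡.refl (ℕ.s≤s (ℕ.s≤s ℕ.z≤n)) 1<q
        }

  maximumScattered : ∀ {u b} → σ u ≈ u → σ (σ b) ≈ b → ¬ (u * u ≈ 1#) → ¬ (b ≈ 0#) →
    b * σ b * u ≈ u * u + 1# - u → IsMaximumScattered (U⟨_,1⟩ K b q)
  maximumScattered {u} {b} σu σ²b u²≉1 b≉0 Bu = U-maximumScattered b collinear⇒proportional
    where
    collinear⇒proportional : ∀ {x y} → ¬ (x ≈ 0#) → x * f b y ≈ y * f b x → ∃ λ a → y ≈ ι⟦ a ⟧ * x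
    collinear⇒proportional {x} {y} x≉0 eq =
      let t , tx≈y = divide y x≉0
          σt≈t = decidable-stable (σ t ≟ t) (CrossRatio.kernel⇒fixed K frobenius σ⁶ σu σ²b u²≉1 b≉0 Bu x≉0
            (trans (*-congˡ (f-cong b tx≈y)) (trans eq (*-congʳ (sym tx≈y)))))
          a , t≈ιa = Eι.fixed⇒image F-order K-order 1<q t σt≈t
      in a , trans (sym tx≈y) (*-congʳ t≈ιa)

-- Choice of b with prescribed norm

module _ {c ℓ} {q} (q-primePower : IsPrimePower q) (4<q : 4 ℕ.< q) (F L K : Field c ℓ)
         (F-order : HasOrder F q) (L-order : HasOrder L (q ℕ.^ 2)) (K-order : HasOrder K (q ℕ.^ 6))
         (ι : Embedding F K) (κ : Embedding L K) where
  private
    module F = Field F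
    module L = Field L
    module K = Field K
    module ι = RingHomomorphism ι
    module κ = RingHomomorphism κ
    module Eι = FieldEmbedding F K ι
    module Eκ = FieldEmbedding L K κ
    module Lₑ = Exp L.commutativeSemiring
    module Kₑ = Exp K.commutativeSemiring

  1<q : 1 ℕ.< q
  1<q = ℕ.<-trans (ℕ.s≤s (ℕ.s≤s ℕ.z≤n)) 4<q

  open Family q-primePower 1<q F K F-order K-order ι

  -- No map from F to L is given. The image of β in K is fixed by x ↦ x^(q²), hence comes from some
  -- β′ in L; injectivity of κ shows that β′ is fixed by x ↦ x^q, so it is a norm.
  norm-from-L : ∀ β → ¬ (β F.≈ F.0#) → ∃ λ b → ¬ (b L.≈ L.0#) × κ.⟦ b ⟧ K.* κ.⟦ b ⟧ Kₑ.^ q K.≈ ι.⟦ β ⟧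
  norm-from-L β β≉0 = b , b≉0 , (begin
      κ.⟦ b ⟧ K.* κ.⟦ b ⟧ Kₑ.^ q   ≈⟨ Eκ.^-homo b (suc q) ⟨
      κ.⟦ b Lₑ.^ suc q ⟧           ≈⟨ κ.⟦⟧-cong (proj₂ norm) ⟩
      κ.⟦ β′ ⟧                     ≈⟨ ιβ≈κβ′ ⟨
      ι.⟦ β ⟧                      ∎)
    where
    open SetoidReasoning K.setoid
    1<q² : 1 ℕ.< q ℕ.^ 2
    1<q² = ℕ.^-monoʳ-< q 1<q {0} {2} (ℕ.s≤s ℕ.z≤n)

    preimage = Eκ.fixed⇒image L-order K-order 1<q² ι.⟦ β ⟧
      (K.trans (K.sym (σ^≈^ 2 _)) (σ^-fixed 2 (σ-ι β)))
    β′ = proj₁ preimage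
    ιβ≈κβ′ = proj₂ preimage

    β′≉0 : ¬ (β′ L.≈ L.0#)
    β′≉0 β′≈0 = Eι.embedding-≉0 F-order β≉0 (K.trans ιβ≈κβ′ (K.trans (κ.⟦⟧-cong β′≈0) κ.0#-homo))

    β′^q≈β′ : β′ Lₑ.^ q L.≈ β′
    β′^q≈β′ = Eκ.embedding-injective L-order (begin
      κ.⟦ β′ Lₑ.^ q ⟧    ≈⟨ Eκ.^-homo β′ q ⟩
      κ.⟦ β′ ⟧ Kₑ.^ q    ≈⟨ Kₑ.^-congˡ q ιβ≈κβ′ ⟨
      ι.⟦ β ⟧ Kₑ.^ q     ≈⟨ σ-ι β ⟩
      ι.⟦ β ⟧            ≈⟨ ιβ≈κβ′ ⟩
      κ.⟦ β′ ⟧           ∎)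

    norm : ∃ λ b → b Lₑ.^ suc q L.≈ β′
    norm = norm-surjective′ 1<q L-order β′^q≈β′
      where
      -- Abstracting q allows it to be matched as m + 2.
      norm-surjective′ : ∀ {q} → 1 ℕ.< q → HasOrder L (q ℕ.^ 2) → β′ Lₑ.^ q L.≈ β′ → ∃ λ b → b Lₑ.^ suc q L.≈ β′
      norm-surjective′ (ℕ.s<s (ℕ.s≤s {n = m} ℕ.z≤n)) order = norm-surjective L m order β′≉0

    b = proj₁ norm
    b≉0 : ¬ (b L.≈ L.0#)
    b≉0 b≈0 = β′≉0 (L.trans (L.sym (proj₂ norm)) (L.trans (L.*-congʳ b≈0) (L.zeroˡ _)))

  exists-maximumScattered : ∃ λ b → ¬ (b L.≈ L.0#) × Scattered.IsMaximumScattered F K ι (U⟨_,1⟩ K κ.⟦ b ⟧ q)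
  exists-maximumScattered =
    let u , u≉0 , u²≉1 , γ≉0 = admissible-parameter F F-order 4<q
        -- The prescribed norm is β = u + 1/u - 1, nonzero because u² - u + 1 is.
        β , βu≈γ = FieldProperties.divide F (u F.* u F.+ F.1# F.- u) u≉0
        b , b≉0 , norm = norm-from-L β (λ β≈0 → γ≉0 (F.trans (F.sym βu≈γ) (F.trans (F.*-congʳ β≈0) (F.zeroˡ u))))
    in b , b≉0 , maximumScattered (σ-ι u)
         (K.trans (σ^≈^ 2 κ.⟦ b ⟧) (Eκ.image-fixed L-order b))
         (λ eq → u²≉1 (Eι.embedding-injective F-order (K.trans (ι.*-homo u u) (K.trans eq (K.sym ι.1#-homo)))))
         (Eκ.embedding-≉0 L-order b≉0)
         (K.trans (K.*-congʳ norm) (K.trans (K.sym (ι.*-homo β u)) (K.trans (ι.⟦⟧-cong βu≈γ)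
           (K.trans (ι.+-homo _ _) (K.+-cong (K.trans (ι.+-homo _ _) (K.+-cong (ι.*-homo u u) ι.1#-homo)) (ι.-‿homo u))))))

open import Data.Nat using (_<_; _^_)

theorem7p1 : ∀ {c ℓ} (q : ℕ) → IsPrimePower q → 4 < q →
    (𝔽q 𝔽q² 𝔽q⁶ : Field c ℓ) →
    HasOrder 𝔽q q → HasOrder 𝔽q² (q ^ 2) → HasOrder 𝔽q⁶ (q ^ 6) →
    (ι : Embedding 𝔽q 𝔽q⁶) (κ : Embedding 𝔽q² 𝔽q⁶) →
    ∃ λ (b : Field.Carrier 𝔽q²) → ¬ (Field._≈_ 𝔽q² b (Field.0# 𝔽q²)) ×
    Scattered.IsMaximumScattered 𝔽q 𝔽q⁶ ι
    (U⟨_,1⟩ 𝔽q⁶ (RingHomomorphism.⟦_⟧ κ b) q)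
theorem7p1 q q-primePower 4<q F L K F-order L-order K-order ι κ =
  exists-maximumScattered q-primePower 4<q F L K F-order L-order K-order ι κ
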